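{- Let $n\ge 5$ be an integer with $n\equiv 1$ or $5 \pmod{20}$. Then there exists a configuration $(1,5)$ $GDD\left(n,2,6;n,\frac{n-1}{2}\right)$.
   Context: A $GDD(n,2,6;\lambda_1,\lambda_2)$ is a finite collection (repetitions allowed) of $6$-element subsets, called blocks, of a $2n$-element set $X$ partitioned into two groups of size $n$, such that every point lies in the same number $r$ of blocks, any two distinct points of the same group lie together in exactly $\lambda_1$ blocks, and any two points from different groups lie together in exactly $\lambda_2$ blocks. It has configuration $(1,5)$ if every block has exactly $1$ point in one of the two groups and $5$ points in the other (which group contains the single point may depend on the block). -}

module Defs where

open import Data.Fin using (Fin)
open import Data.Fin.Subset using (Subset; _∈_; _∩_; ∣_∣)
open import Data.Fin.Subset.Properties using (_∈?_)
open import Data.List using (List; length; filter)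
open import Data.List.Relation.Unary.All using (All)
open import Data.Nat using (ℕ; _*_)
open import Data.Product using (_×_; ∃!; ∃₂)
open import Relation.Binary.PropositionalEquality using (_≡_; _≢_)
open import Relation.Nullary.Decidable using (_×-dec_)

-- Blocks form a list, so repeated blocks are counted with multiplicity.

replication : ∀ {v} → List (Subset v) → Fin v → ℕ
replication bs x = length (filter (x ∈?_) bs)

concurrence : ∀ {v} → List (Subset v) → Fin v → Fin v → ℕ
concurrence bs x y = length (filter (λ B → (x ∈? B) ×-dec (y ∈? B)) bs)

-- GDD(n, m, k; λ₁, λ₂): m groups of size n, blocks of size k.

record GDD (n m k λ₁ λ₂ : ℕ) : Set where
  field
    group           : Fin m → Subset (m * n)
    group-size      : ∀ g → ∣ group g ∣ ≡ n
    group-partition : ∀ x → ∃! _≡_ (λ g → x ∈ group g)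
    blocks          : List (Subset (m * n))
    block-size      : All (λ B → ∣ B ∣ ≡ k) blocks
    r               : ℕ
    regular         : ∀ x → replication blocks x ≡ r
    same-group      : ∀ {g x y} → x ∈ group g → y ∈ group g → x ≢ y →
                      concurrence blocks x y ≡ λ₁
    different-group : ∀ {g h x y} → g ≢ h → x ∈ group g → y ∈ group h →
                      concurrence blocks x y ≡ λ₂

-- The groups g and h are chosen separately for each block.

HasConfiguration : ∀ {n k λ₁ λ₂} → ℕ → ℕ → GDD n 2 k λ₁ λ₂ → Set
HasConfiguration s t D =
  All (λ B → ∃₂ λ g h → g ≢ h × ∣ B ∩ group g ∣ ≡ s × ∣ B ∩ group h ∣ ≡ t) blocks
  where open GDD D

{-# OPTIONS --safe #-}
module Submission where

-- If the 5-sets B form an (n, 5, 1)-BIBD on each of the two groups, then the sets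
-- B ∪ {y}, with y running over the other group, are the blocks of the required
-- design: two points of a group lie together in n blocks, and points of different
-- groups in 2 · (n − 1)/4 blocks.  So it remains to prove Hanani's theorem that an
-- (n, 5, 1)-BIBD exists for n ≡ 1, 5 (mod 20).
--
-- Write n = 4 r + 1 with r ≡ 0, 1 (mod 5).  Deleting a point turns the BIBD into a
-- 5-GDD of type 4^r, and Wilson's fundamental construction shows that the set of
-- these r is closed under pairwise balanced designs: from a design on r points
-- whose block sizes are in the set, r is in the set.  Now m points in each of five
-- columns and x ≤ m points in a sixth one, completed by w ≤ 1 points at infinity,
-- carry a pairwise balanced design with block sizes 5, 6, m + w and x + w, obtained
-- by truncating the linear transversal design TD(6, m) over ℤ/m, gcd(m, 6) = 1.
-- This reduces every r ≥ 305 to smaller orders, and the smaller orders to finitely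
-- many difference families, which were found by computer and are checked here by
-- evaluation.

open import Algebra.Bundles using (AbelianGroup)
import Algebra.Consequences.Propositional as Consequences
import Algebra.Properties.AbelianGroup as AbelianGroupProperties
import Algebra.Properties.CommutativeMonoid.Mult as Mult
open import Algebra.Structures using (IsAbelianGroup)
open import Data.Bool using (Bool; true; false; if_then_else_)
import Data.Empty as Empty
import Data.Empty.Irrelevant as Irrelevant
open import Data.Fin using (Fin; zero; suc; toℕ; fromℕ<; punchIn; punchOut; splitAt; join; combine; remQuot; _↑ˡ_; _↑ʳ_)
open import Data.Fin.Properties as Fin using (0≢1+n; toℕ<n; toℕ-injective; suc-injective; fromℕ<-toℕ; toℕ-fromℕ<; punchIn-injective; punchInᵢ≢i; punchIn-punchOut; splitAt-join; join-splitAt; combine-injective; combine-remQuot; remQuot-combine; cantor-schröder-bernstein)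
open import Data.Fin.Subset using (Subset; inside; outside; _∈_; _∉_; _∪_; _∩_; ∣_∣; ⁅_⁆; ⊤; ⊥)
open import Data.Fin.Subset.Properties using (_∈?_; ∈⊤; ∉⊥; x∈⁅x⁆; x∈⁅y⁆⇒x≡y; x∈p∪q⁺; x∈p∪q⁻; ∪-identityˡ; ∩-zeroʳ; ∩-identityʳ; ∣⊥∣≡0; ∣⊤∣≡n; ∣⁅x⁆∣≡1)
open import Data.List using (List; []; _∷_; _++_; length; lookup; filter; map; concatMap; allFin; upTo; cartesianProduct; cartesianProductWith)
open import Data.List.Membership.Propositional using (find; lose) renaming (_∈_ to _∈ˡ_)
open import Data.List.Membership.Propositional.Properties using (∈-allFin; ∈-cartesianProduct⁺; ∈-concatMap⁺; ∈-filter⁺; ∈-filter⁻; ∈-lookup; ∈-map⁺; ∈-map⁻; ∈-upTo⁺)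
open import Data.List.Properties using (filter-accept; filter-reject; filter-≐; filter-++; length-++; length-tabulate)
open import Data.List.Relation.Unary.All as All using (All; []; _∷_; all?)
import Data.List.Relation.Unary.All.Properties as All
open import Data.List.Relation.Unary.AllPairs using (AllPairs; []; _∷_; allPairs?)
import Data.List.Relation.Unary.AllPairs.Properties as AllPairs
open import Data.List.Relation.Unary.Any using (Any; here; there; index; any?)
open import Data.List.Relation.Unary.Any.Properties using (lookup-index)
open import Data.List.Relation.Unary.Unique.Propositional using (Unique)
import Data.List.Relation.Unary.Unique.Propositional.Properties as Unique
open import Data.Nat as ℕ using (ℕ; zero; suc; _+_; _*_; _∸_; _≤_; _<_; z≤n; s≤s; NonZero; _/_; _%_)
open import Data.Nat.Divisibility using (divides)
open import Data.Nat.DivMod using (m≡m%n+[m/n]*n; m%n<n; m%n%n≡m%n; m<n⇒m%n≡m; n%n≡0; m*n%n≡0; [m+kn]%n≡m%n; %-distribˡ-+; m∣n⇒o%n%m≡o%m; m*n/n≡m; m<n*o⇒m/o<n; /-monoˡ-≤)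
open import Data.Nat.Induction using (<-rec)
import Data.Nat.Properties as ℕ
open import Data.Nat.Tactic.RingSolver using (solve-∀)
open import Data.Product using (Σ; ∃; ∃₂; ∃!; _×_; _,_; proj₁; proj₂)
open import Data.Product.Properties using (≡-dec; ,-injectiveʳ)
open import Data.Sum as Sum using (_⊎_; inj₁; inj₂; [_,_]′)
open import Data.Sum.Properties using (inj₁-injective; inj₂-injective)
import Data.Unit as Unit
open import Data.Vec using ([]; _∷_; here; there) renaming (_++_ to _⧺_)
open import Data.Vec.Functional using (removeAt)
open import Data.Vec.Properties using ([]=⇒lookup; lookup⇒[]=; lookup-++ˡ; lookup-++ʳ; zipWith-++)
open import Function using (id; _∘_; case_of_)
open import Level using (0ℓ)
open import Relation.Binary.Definitions using (DecidableEquality; tri<; tri≈; tri>)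
open import Relation.Binary.PropositionalEquality
open import Relation.Nullary using (Dec; does; yes; no; contradiction)
open import Relation.Nullary.Decidable using (map′; recompute; decidable-stable; ¬?; _×-dec_; _⊎-dec_; _→-dec_)
open import Relation.Unary using (Decidable; _≐_)
open import Algebra.Properties.CommutativeMonoid.Sum ℕ.+-0-commutativeMonoid using (sum; sum-cong-≗; sum-remove; ∑-distrib-+)
open import Data.List.Membership.DecPropositional ℕ._≟_ using () renaming (_∈?_ to _∈ˡ?_)
open import Defs

-- What shapes the recursion is that every block size has to stay in the class 0, 1 (mod 5). Five
-- columns fit because 5 and 6 lie in this class and because five columns of equal size m contribute
-- 0 modulo 5: without a point at infinity x ≡ r (mod 5), so the truncated column is admissible for
-- free and only m has to be chosen in the class. The linear transversal design needs the column
-- distances 1, 2, 3, 4 to be invertible, whence m prime to 6. Such m are sparse at small orders,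
-- where two more devices help: a BIBD on r = 4 s + 1 points is itself a pairwise balanced design on
-- r points with block size 5, and ten columns of size 11 replace five.
--
-- Designs carry an arbitrary type of blocks, with existence and uniqueness of the joining block,
-- which suits the recursive constructions. The lists of subsets that a `GDD` counts appear only
-- once the BIBD is complete.

-- A group divisible design of index 1 on the point set X: the groups are the
-- fibres of g, and two points lie in a common block, which is then unique,
-- exactly if they are in different groups.

record GroupDivisible {X G : Set} (g : X → G) (K : ℕ → Set) : Set₁ where
  field
    Block       : Set
    size        : Block → ℕ
    size-K      : ∀ b → K (size b)
    point       : ∀ b → Fin (size b) → X
    transversal : ∀ b {i j} → g (point b i) ≡ g (point b j) → i ≡ j
    common      : ∀ {x y} → g x ≢ g y →
                  Σ Block λ b → ∃₂ λ i j → point b i ≡ x × point b j ≡ y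
    unique      : ∀ {b b′ i j i′ j′} → i ≢ j →
                  point b i ≡ point b′ i′ → point b j ≡ point b′ j′ → b ≡ b′

PairwiseBalanced : Set → (ℕ → Set) → Set₁
PairwiseBalanced X = GroupDivisible {X} id

open GroupDivisible

-- Transport of designs along bijections

record _≅_ (X Y : Set) : Set where
  constructor iso
  field
    to      : X → Y
    from    : Y → X
    from-to : ∀ x → from (to x) ≡ x
    to-from : ∀ y → to (from y) ≡ y

open _≅_

-- Only the fibres of `g` and `h` have to correspond, not their codomains: in `delete` the labels of
-- the groups change from `Fin n` to `Fin r`.
relabel : ∀ {X Y G H K} {g : X → G} {h : Y → H} → GroupDivisible g K → (f : X ≅ Y) →
          (∀ {x x′} → g x ≡ g x′ → h (to f x) ≡ h (to f x′)) →
          (∀ {x x′} → h (to f x) ≡ h (to f x′) → g x ≡ g x′) →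
          GroupDivisible h K
relabel D f g⇒h h⇒g .Block = Block D
relabel D f g⇒h h⇒g .size = size D
relabel D f g⇒h h⇒g .size-K = size-K D
relabel D f g⇒h h⇒g .point b i = to f (point D b i)
relabel D f g⇒h h⇒g .transversal b eq = transversal D b (h⇒g eq)
relabel {h = h} D f g⇒h h⇒g .common {x} {y} hx≢hy
  with b , i , j , p , q ← common D {from f x} {from f y}
         (λ eq → hx≢hy (subst₂ (λ u v → h u ≡ h v) (to-from f x) (to-from f y) (g⇒h eq)))
  = b , i , j , trans (cong (to f) p) (to-from f x) , trans (cong (to f) q) (to-from f y)
relabel D f g⇒h h⇒g .unique i≢j p q = unique D i≢j (to-inj p) (to-inj q)
  where
  to-inj : ∀ {x x′} → to f x ≡ to f x′ → x ≡ x′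
  to-inj {x} {x′} eq = trans (sym (from-to f x)) (trans (cong (from f) eq) (from-to f x′))

relabelPoints : ∀ {X Y K} → X ≅ Y → PairwiseBalanced X K → PairwiseBalanced Y K
relabelPoints f D = relabel D f (cong (to f))
  (λ {x} {x′} eq → trans (sym (from-to f x)) (trans (cong (from f) eq) (from-to f x′)))

weaken : ∀ {X G K K′} {g : X → G} → (∀ {k} → K k → K′ k) → GroupDivisible g K → GroupDivisible g K′
weaken f D = record { GroupDivisible D hiding (size-K) ; size-K = f ∘ size-K D }

-- Inflating points and filling groups

-- Wilson's fundamental construction with constant weight ∣F∣.

inflate : ∀ {X G F K K′} {g : X → G} → GroupDivisible g K →
          (∀ {k} → K k → GroupDivisible {Fin k × F} proj₁ K′) →
          GroupDivisible {X × F} (g ∘ proj₁) K′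
inflate D E .Block = Σ (Block D) λ b → Block (E (size-K D b))
inflate D E .size (b , c) = size (E (size-K D b)) c
inflate D E .size-K (b , c) = size-K (E (size-K D b)) c
inflate D E .point (b , c) i with s , a ← point (E (size-K D b)) c i = point D b s , a
inflate D E .transversal (b , c) eq = transversal (E (size-K D b)) c (transversal D b eq)
inflate D E .common {x , a} {y , a′} gx≢gy
  with b , s , t , refl , refl ← common D gx≢gy
  with c , i , j , p , q ← common (E (size-K D b)) {s , a} {t , a′} (λ { refl → gx≢gy refl })
  = (b , c) , i , j , cong (λ (s , a) → point D b s , a) p , cong (λ (s , a) → point D b s , a) q
inflate {g = g} D E .unique {b , c} {b′ , c′} {i} {j} i≢j p q
  -- Distinct positions of `c` lie over distinct points of `b`, so the projections determine `b`
  -- before `c` is compared.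
  with refl ← unique D {b} {b′} (λ eq → i≢j (transversal (E (size-K D b)) c eq))
                     (cong proj₁ p) (cong proj₁ q)
  = cong (b ,_) (unique (E (size-K D b)) i≢j (same-point p) (same-point q))
  where
  same-point : ∀ {u v : Fin (size D b) × _} →
               (point D b (proj₁ u) , proj₂ u) ≡ (point D b (proj₁ v) , proj₂ v) → u ≡ v
  same-point eq = cong₂ _,_ (transversal D b (cong (g ∘ proj₁) eq)) (cong proj₂ eq)

Fin-irrelevant : ∀ {w} → w ≤ 1 → (i j : Fin w) → i ≡ j
Fin-irrelevant (s≤s z≤n) zero zero = refl

splitAt-injective : ∀ m {n} {i j : Fin (m + n)} → splitAt m i ≡ splitAt m j → i ≡ j
splitAt-injective m {n} {i} {j} eq =
  trans (sym (join-splitAt m n i)) (trans (cong (join m n) eq) (join-splitAt m n j))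

-- Every group, extended by the w ≤ 1 points at infinity, becomes a block.

fill : ∀ {X G K w} {g : X → G} → DecidableEquality G → GroupDivisible g K → w ≤ 1 →
       (z : G → ℕ) (ι : ∀ γ → Fin (z γ) → X) →
       (∀ γ {i j} → ι γ i ≡ ι γ j → i ≡ j) →
       (∀ γ i → g (ι γ i) ≡ γ) →
       (∀ x → ∃ λ i → ι (g x) i ≡ x) →
       (∀ γ → K (z γ + w)) →
       PairwiseBalanced (X ⊎ Fin w) K
fill {X} {G} {K} {w} {g} _≟_ D w≤1 z ι ι-inj ι-group ι-onto zK = record
  { Block       = Block D ⊎ G
  ; size        = [ size D , (λ γ → z γ + w) ]′
  ; size-K      = λ { (inj₁ b) → size-K D b ; (inj₂ γ) → zK γ }
  ; point       = pt
  ; transversal = pt-injective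
  ; common      = pt-common
  ; unique      = λ {b} {b′} → pt-unique b b′
  }
  where
  end : ∀ γ → Fin (z γ) ⊎ Fin w → X ⊎ Fin w
  end γ = Sum.map (ι γ) id

  pt : ∀ b → Fin ([ size D , (λ γ → z γ + w) ]′ b) → X ⊎ Fin w
  pt (inj₁ b) i = inj₁ (point D b i)
  pt (inj₂ γ) i = end γ (splitAt (z γ) i)

  end-injective : ∀ γ {u v} → end γ u ≡ end γ v → u ≡ v
  end-injective γ {inj₁ _} {inj₁ _} eq = cong inj₁ (ι-inj γ (inj₁-injective eq))
  end-injective γ {inj₂ _} {inj₂ _} eq = cong inj₂ (inj₂-injective eq)

  pt-injective : ∀ b {i j} → pt b i ≡ pt b j → i ≡ j
  pt-injective (inj₁ b) eq = transversal D b (cong g (inj₁-injective eq))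
  pt-injective (inj₂ γ) eq = splitAt-injective (z γ) (end-injective γ eq)

  pt-join : ∀ γ u → pt (inj₂ γ) (join (z γ) w u) ≡ end γ u
  pt-join γ u = cong (end γ) (splitAt-join (z γ) w u)

  in-group : ∀ {x} γ → g x ≡ γ → ∃ λ i → pt (inj₂ γ) i ≡ inj₁ x
  in-group {x} _ refl with i , eq ← ι-onto x = _ , trans (pt-join _ (inj₁ i)) (cong inj₁ eq)

  at-∞ : ∀ γ k → ∃ λ i → pt (inj₂ γ) i ≡ inj₂ k
  at-∞ γ k = _ , pt-join γ (inj₂ k)

  pt-common : ∀ {x y} → x ≢ y → Σ (Block D ⊎ G) λ b → ∃₂ λ i j → pt b i ≡ x × pt b j ≡ y
  pt-common {inj₁ x} {inj₁ y} x≢y with g x ≟ g y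
  ... | no gx≢gy with b , i , j , p , q ← common D gx≢gy = inj₁ b , i , j , cong inj₁ p , cong inj₁ q
  ... | yes gx≡gy with i , p ← in-group (g y) gx≡gy | j , q ← in-group (g y) refl =
    inj₂ (g y) , i , j , p , q
  pt-common {inj₁ x} {inj₂ k} _ with i , p ← in-group (g x) refl | j , q ← at-∞ (g x) k =
    inj₂ (g x) , i , j , p , q
  pt-common {inj₂ k} {inj₁ x} _ with i , p ← in-group (g x) refl | j , q ← at-∞ (g x) k =
    inj₂ (g x) , j , i , q , p
  pt-common {inj₂ k} {inj₂ l} x≢y = contradiction (cong inj₂ (Fin-irrelevant w≤1 k l)) x≢y

  end-group : ∀ γ u {x} → end γ u ≡ inj₁ x → g x ≡ γ
  end-group γ (inj₁ i) refl = ι-group γ i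

  -- As w ≤ 1, two positions cannot both be at infinity. The finite point then names the group,
  -- which is why two extended groups share no pair.
  finite-point : ∀ {γ i j} → i ≢ j → (∃ λ x → pt (inj₂ γ) i ≡ inj₁ x) ⊎ (∃ λ x → pt (inj₂ γ) j ≡ inj₁ x)
  finite-point {γ} {i} {j} i≢j with splitAt (z γ) i in eqᵢ | splitAt (z γ) j in eqⱼ
  ... | inj₁ _ | _      = inj₁ (_ , refl)
  ... | inj₂ _ | inj₁ _ = inj₂ (_ , refl)
  ... | inj₂ k | inj₂ l = contradiction
    (splitAt-injective (z γ) (trans eqᵢ (trans (cong inj₂ (Fin-irrelevant w≤1 k l)) (sym eqⱼ)))) i≢j

  not-in-group : ∀ {b γ i j i′ j′} → i ≢ j → pt (inj₂ γ) i′ ≡ inj₁ (point D b i) →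
                 pt (inj₂ γ) j′ ≢ inj₁ (point D b j)
  not-in-group {b} {γ} {i′ = i′} {j′} i≢j p q = i≢j (transversal D b
    (trans (end-group γ (splitAt (z γ) i′) p) (sym (end-group γ (splitAt (z γ) j′) q))))

  pt-unique : ∀ b b′ {i j i′ j′} → i ≢ j → pt b i ≡ pt b′ i′ → pt b j ≡ pt b′ j′ → b ≡ b′
  pt-unique (inj₁ b) (inj₁ b′) i≢j p q = cong inj₁ (unique D i≢j (inj₁-injective p) (inj₁-injective q))
  pt-unique (inj₁ b) (inj₂ γ) i≢j p q = contradiction (sym q) (not-in-group i≢j (sym p))
  pt-unique (inj₂ γ) (inj₁ b) i≢j p q = contradiction q
    (not-in-group (λ { refl → i≢j (pt-injective (inj₂ γ) (trans p (sym q))) }) p)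
  pt-unique (inj₂ γ) (inj₂ γ′) {i} {j} {i′} {j′} i≢j p q with finite-point i≢j
  ... | inj₁ (x , r) = cong inj₂ (trans (sym (end-group γ (splitAt (z γ) i) r))
                                         (end-group γ′ (splitAt (z γ′) i′) (trans (sym p) r)))
  ... | inj₂ (x , r) = cong inj₂ (trans (sym (end-group γ (splitAt (z γ) j) r))
                                         (end-group γ′ (splitAt (z γ′) j′) (trans (sym q) r)))

-- Deleting a point

module Lines {X G : Set} {g : X → G} {k} (D : GroupDivisible g (_≡ k)) where

  line : Block D → Fin k → X
  -- The size of a block equals `k` only propositionally; the transport gives all blocks the same
  -- index type.
  line b i = point D b (subst Fin (sym (size-K D b)) i)

  line-transversal : ∀ b {i j} → g (line b i) ≡ g (line b j) → i ≡ j
  line-transversal b eq = subst-injective (sym (size-K D b)) (transversal D b eq)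

  line-common : ∀ {x y} → g x ≢ g y → Σ (Block D) λ b → ∃₂ λ i j → line b i ≡ x × line b j ≡ y
  line-common gx≢gy with b , i , j , p , q ← common D gx≢gy =
    b , subst Fin (size-K D b) i , subst Fin (size-K D b) j ,
    trans (cong (point D b) (subst-sym-subst (size-K D b))) p ,
    trans (cong (point D b) (subst-sym-subst (size-K D b))) q

  line-unique : ∀ {b b′ i j i′ j′} → i ≢ j → line b i ≡ line b′ i′ → line b j ≡ line b′ j′ → b ≡ b′
  line-unique {b} i≢j = unique D (i≢j ∘ subst-injective (sym (size-K D b)))

lookup-injective : ∀ {A : Set} {xs : List A} → Unique xs → ∀ {i j} → lookup xs i ≡ lookup xs j → i ≡ j
lookup-injective (x∉ ∷ xs!) {zero}  {zero}  eq = refl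
lookup-injective (x∉ ∷ xs!) {zero}  {suc j} eq = contradiction eq (All.lookup x∉ (∈-lookup j))
lookup-injective (x∉ ∷ xs!) {suc i} {zero}  eq = contradiction (sym eq) (All.lookup x∉ (∈-lookup i))
lookup-injective (x∉ ∷ xs!) {suc i} {suc j} eq = cong suc (lookup-injective xs! eq)

-- Classes of size suc c on Fin n: mate y a is the a-th element of the class of
-- y, and pos y is the position of y in its class.

module Classes {n c} (pos : Fin n → Fin (suc c)) (mate : Fin n → Fin (suc c) → Fin n)
               (pos-mate : ∀ y a → pos (mate y a) ≡ a)
               (mate-mate : ∀ y a a′ → mate (mate y a) a′ ≡ mate y a′)
               (mate-pos : ∀ y → mate y (pos y) ≡ y) where

  private
    leads : List (Fin n)
    leads = filter (λ y → pos y Fin.≟ zero) (allFin n)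

    lead : Fin (length leads) → Fin n
    lead = lookup leads

    pos-lead : ∀ s → pos (lead s) ≡ zero
    pos-lead s = proj₂ (∈-filter⁻ (λ y → pos y Fin.≟ zero) {xs = allFin n} (∈-lookup s))

    mate-lead : ∀ s → mate (lead s) zero ≡ lead s
    mate-lead s = trans (cong (mate (lead s)) (sym (pos-lead s))) (mate-pos (lead s))

    lead∈ : ∀ y → mate y zero ∈ˡ leads
    lead∈ y = ∈-filter⁺ (λ y → pos y Fin.≟ zero) (∈-allFin _) (pos-mate y zero)

    lead-index : ∀ y → mate y zero ≡ lead (index (lead∈ y))
    lead-index y = lookup-index (lead∈ y)

    class : ∀ {s y} → mate y zero ≡ lead s → index (lead∈ y) ≡ s
    class {s} {y} eq = lookup-injective (Unique.filter⁺ (λ y → pos y Fin.≟ zero) (Unique.allFin⁺ n))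
      (trans (sym (lead-index y)) eq)

    coordinates : Fin n ≅ (Fin (length leads) × Fin (suc c))
    coordinates .to y = index (lead∈ y) , pos y
    coordinates .from (s , a) = mate (lead s) a
    coordinates .from-to y = trans (cong (λ z → mate z (pos y)) (sym (lead-index y)))
                                   (trans (mate-mate y zero (pos y)) (mate-pos y))
    coordinates .to-from (s , a) = cong₂ _,_
      (class (trans (mate-mate (lead s) a zero) (mate-lead s))) (pos-mate (lead s) a)

    -- The number of classes is only known as the length of a filtered list. The coordinates give
    -- injections between `Fin (length leads * suc c)` and `Fin n` both ways, which forces equality;
    -- cancelling `suc c` then identifies the number with `r`.
    length-leads : length leads * suc c ≡ n
    length-leads = cantor-schröder-bernstein
      {f = λ i → from coordinates (remQuot (suc c) i)}
      {g = λ y → combine (proj₁ (to coordinates y)) (proj₂ (to coordinates y))}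
      (λ {i} {j} eq → trans (sym (combine-remQuot {length leads} (suc c) i))
        (trans (cong (λ (s , a) → combine s a)
        (trans (sym (to-from coordinates _)) (trans (cong (to coordinates) eq) (to-from coordinates _))))
        (combine-remQuot {length leads} (suc c) j)))
      (λ {x} {y} eq → case combine-injective _ _ _ _ eq of λ (p , q) →
        trans (sym (from-to coordinates x)) (trans (cong (from coordinates) (cong₂ _,_ p q))
          (from-to coordinates y)))

  splitClasses : ∀ r → n ≡ r * suc c → Σ (Fin n ≅ (Fin r × Fin (suc c))) λ f →
    (∀ {y y′} → mate y zero ≡ mate y′ zero → proj₁ (to f y) ≡ proj₁ (to f y′)) ×
    (∀ {y y′} → proj₁ (to f y) ≡ proj₁ (to f y′) → mate y zero ≡ mate y′ zero)
  splitClasses r n≡ with refl ← ℕ.*-cancelʳ-≡ (length leads) r (suc c) (trans length-leads n≡) =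
    coordinates ,
    (λ {y} {y′} eq → class {y = y} (trans eq (lead-index y′))) ,
    (λ {y} {y′} eq → trans (lead-index y) (trans (cong lead eq) (sym (lead-index y′))))

-- The proof is irrelevant so that a line avoiding the deleted point is determined by its block
-- alone, as `ext` requires.
predecessor : ∀ {n} (x : Fin (suc n)) → .(zero ≢ x) → Fin n
predecessor zero    0≢0 = Irrelevant.⊥-elim (0≢0 refl)
predecessor (suc x) _   = x

suc-predecessor : ∀ {n} (x : Fin (suc n)) .(0≢x : zero ≢ x) → suc (predecessor x 0≢x) ≡ x
suc-predecessor zero    0≢0 = Irrelevant.⊥-elim (0≢0 refl)
suc-predecessor (suc x) _   = refl

-- The lines through the deleted point, without that point, become the groups.

module Deletion {n k} (D : PairwiseBalanced (Fin (suc n)) (_≡ suc (suc k))) where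
  open Lines D

  private
    abstract
      through : (y : Fin n) → Σ (Block D) λ b → ∃₂ λ i j → line b i ≡ zero × line b j ≡ suc y
      through y = line-common 0≢1+n

    blk : Fin n → Block D
    blk y = proj₁ (through y)

    hub at : Fin n → Fin (suc (suc k))
    hub y = proj₁ (proj₂ (through y))
    at y = proj₁ (proj₂ (proj₂ (through y)))

    line-hub : ∀ y → line (blk y) (hub y) ≡ zero
    line-hub y = proj₁ (proj₂ (proj₂ (proj₂ (through y))))

    line-at : ∀ y → line (blk y) (at y) ≡ suc y
    line-at y = proj₂ (proj₂ (proj₂ (proj₂ (through y))))

    hub≢at : ∀ y → hub y ≢ at y
    hub≢at y eq = 0≢1+n (trans (sym (line-hub y)) (trans (cong (line (blk y)) eq) (line-at y)))

    blk-unique : ∀ {y b i j} → line b i ≡ zero → line b j ≡ suc y → blk y ≡ b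
    blk-unique {y} p q = line-unique (hub≢at y) (trans (line-hub y) (sym p)) (trans (line-at y) (sym q))

    hub-unique : ∀ {y b i j} → line b i ≡ zero → line b j ≡ suc y → hub y ≡ i
    hub-unique {y} p q with refl ← blk-unique {y} p q = line-transversal (blk y)
      (trans (line-hub y) (sym p))

    at-unique : ∀ {y b i j} → line b i ≡ zero → line b j ≡ suc y → at y ≡ j
    at-unique {y} p q with refl ← blk-unique {y} p q = line-transversal (blk y) (trans (line-at y) (sym q))

    pos : Fin n → Fin (suc k)
    pos y = punchOut (hub≢at y)

    mate-≢ : ∀ y a → zero ≢ line (blk y) (punchIn (hub y) a)
    mate-≢ y a eq = punchInᵢ≢i (hub y) a (line-transversal (blk y) (trans (sym eq) (sym (line-hub y))))

    mate : Fin n → Fin (suc k) → Fin n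
    mate y a = predecessor _ (mate-≢ y a)

    line-mate : ∀ y a → line (blk y) (punchIn (hub y) a) ≡ suc (mate y a)
    line-mate y a = sym (suc-predecessor _ (mate-≢ y a))

    blk-mate : ∀ y a → blk (mate y a) ≡ blk y
    blk-mate y a = blk-unique (line-hub y) (line-mate y a)

    pos-mate : ∀ y a → pos (mate y a) ≡ a
    pos-mate y a = punchIn-injective (hub y) _ _ (trans
      (cong (λ h → punchIn h (pos (mate y a))) (sym (hub-unique (line-hub y) (line-mate y a))))
      (trans (punchIn-punchOut (hub≢at (mate y a))) (at-unique (line-hub y) (line-mate y a))))

    mate-mate : ∀ y a a′ → mate (mate y a) a′ ≡ mate y a′
    mate-mate y a a′ = suc-injective (trans (sym (line-mate (mate y a) a′)) (trans
      (cong₂ (λ b h → line b (punchIn h a′)) (blk-mate y a) (hub-unique (line-hub y) (line-mate y a)))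
      (line-mate y a′)))

    mate-pos : ∀ y → mate y (pos y) ≡ y
    mate-pos y = suc-injective (trans (sym (line-mate y (pos y)))
      (trans (cong (line (blk y)) (punchIn-punchOut (hub≢at y))) (line-at y)))

    collinear⇒blk : ∀ {y y′} → mate y zero ≡ mate y′ zero → blk y ≡ blk y′
    collinear⇒blk {y} {y′} eq = trans (sym (blk-mate y zero)) (trans (cong blk eq) (blk-mate y′ zero))

    blk⇒collinear : ∀ {y y′} → blk y ≡ blk y′ → mate y zero ≡ mate y′ zero
    blk⇒collinear {y} {y′} eq =
      trans (cong (λ z → mate z zero) (sym y≡)) (mate-mate y′ (pos y) zero)
      where
      hub≡ : hub y ≡ hub y′
      hub≡ = hub-unique {y} (line-hub y′) (trans (cong (λ b → line b (at y)) (sym eq)) (line-at y))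
      y≡ : mate y′ (pos y) ≡ y
      y≡ = suc-injective (trans (sym (line-mate y′ (pos y)))
        (trans (cong₂ (λ b h → line b (punchIn h (pos y))) (sym eq) (sym hub≡))
        (trans (line-mate y (pos y)) (cong suc (mate-pos y)))))

    record Avoiding : Set where
      constructor avoiding
      field
        block   : Block D
        .avoids : ∀ i → zero ≢ line block i

    open Avoiding

    pt : Avoiding → Fin (suc (suc k)) → Fin n
    pt (avoiding b p) i = predecessor (line b i) (p i)

    suc-pt : ∀ b i → suc (pt b i) ≡ line (block b) i
    suc-pt (avoiding b p) i = suc-predecessor (line b i) (p i)

    -- Two points of `b` on one line through the deleted point would make `b` that line, although
    -- `b` avoids the point.
    off-transversal : ∀ b {i j} → mate (pt b i) zero ≡ mate (pt b j) zero → i ≡ j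
    off-transversal (avoiding b p) {i} {j} eq = decidable-stable (i Fin.≟ j) λ i≢j →
      let b≡ : b ≡ blk y
          b≡ = line-unique i≢j (trans (sym (suc-pt (avoiding b p) i)) (sym (line-at y)))
                 (trans (sym (suc-pt (avoiding b p) j)) (trans (sym (line-at y′))
                   (cong (λ b′ → line b′ (at y′)) (sym (collinear⇒blk eq)))))
      in Irrelevant.⊥-elim (p (hub y)
           (trans (sym (line-hub y)) (cong (λ b′ → line b′ (hub y)) (sym b≡))))
      where
      y  = pt (avoiding b p) i
      y′ = pt (avoiding b p) j

    off-common : ∀ {y y′} → mate y zero ≢ mate y′ zero →
                 Σ Avoiding λ b → ∃₂ λ i j → pt b i ≡ y × pt b j ≡ y′
    off-common {y} {y′} y≁y′ =
      let b , i , j , p , q = line-common {suc y} {suc y′} (λ { refl → y≁y′ refl })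
          off : ∀ h → zero ≢ line b h
          off h 0≡ = y≁y′ (blk⇒collinear (trans (blk-unique {y} (sym 0≡) p)
            (sym (blk-unique {y′} (sym 0≡) q))))
          b′ = avoiding b off
      in b′ , i , j , suc-injective (trans (suc-pt b′ i) p) , suc-injective (trans (suc-pt b′ j) q)

    ext : ∀ {b b′ : Avoiding} → block b ≡ block b′ → b ≡ b′
    ext refl = refl

    off-unique : ∀ {b b′ i j i′ j′} → i ≢ j → pt b i ≡ pt b′ i′ → pt b j ≡ pt b′ j′ → b ≡ b′
    off-unique {b} {b′} {i} {j} {i′} {j′} i≢j p q = ext
      (line-unique i≢j (trans (sym (suc-pt b i)) (trans (cong suc p) (suc-pt b′ i′)))
                       (trans (sym (suc-pt b j)) (trans (cong suc q) (suc-pt b′ j′))))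

    residual : GroupDivisible (λ y → mate y zero) (_≡ suc (suc k))
    residual .Block = Avoiding
    residual .size _ = suc (suc k)
    residual .size-K _ = refl
    residual .point = pt
    residual .transversal = off-transversal
    residual .common = off-common
    residual .unique {b} {b′} = off-unique {b} {b′}

  delete : ∀ r → n ≡ r * suc k → GroupDivisible {Fin r × Fin (suc k)} proj₁ (_≡ suc (suc k))
  delete r n≡ =
    let f , to⇒ , ⇐to = Classes.splitClasses pos mate pos-mate mate-mate mate-pos r n≡
    in relabel residual f to⇒ ⇐to

open Deletion using (delete)

-- Finite cyclic groups

abelianGroup : {A : Set} (_⊕_ : A → A → A) (0# : A) (-_ : A → A) →
               (∀ x y z → (x ⊕ y) ⊕ z ≡ x ⊕ (y ⊕ z)) → (∀ x y → x ⊕ y ≡ y ⊕ x) →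
               (∀ x → 0# ⊕ x ≡ x) → (∀ x → (- x) ⊕ x ≡ 0#) → IsAbelianGroup _≡_ _⊕_ 0# -_
abelianGroup _⊕_ 0# -_ assoc comm identityˡ inverseˡ = record
  { isGroup = record
    { isMonoid = record
      { isSemigroup = record
        { isMagma = record { isEquivalence = isEquivalence ; ∙-cong = cong₂ _⊕_ }
        ; assoc = assoc }
      ; identity = Consequences.comm∧idˡ⇒id comm identityˡ }
    ; inverse = Consequences.comm∧invˡ⇒inv comm inverseˡ
    ; ⁻¹-cong = cong -_ }
  ; comm = comm }

record Abelian (A : Set) : Set where
  field
    plus  : A → A → A
    nil   : A
    minus : A → A
    isAbelianGroup : IsAbelianGroup _≡_ plus nil minus

  group : AbelianGroup 0ℓ 0ℓ
  group = record { isAbelianGroup = isAbelianGroup }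

  open AbelianGroup group public using (identityˡ; identityʳ; inverseˡ)
    renaming (_∙_ to _⊕_; _-_ to _⊖_; assoc to ⊕-assoc; comm to ⊕-comm)
  open AbelianGroupProperties group public using (//-rightDividesˡ; //-rightDividesʳ; ∙-cancelˡ; ∙-cancelʳ)
  open Mult (AbelianGroup.commutativeMonoid group) public using (×-homo-+; ×-assocˡ; ×-homo-1)
    renaming (_×_ to _·_)

  x⊕y⊖x : ∀ x y → (x ⊕ y) ⊖ x ≡ y
  x⊕y⊖x x y = trans (cong (_⊖ x) (⊕-comm x y)) (//-rightDividesʳ x y)

  x⊕[y⊖x] : ∀ x y → x ⊕ (y ⊖ x) ≡ y
  x⊕[y⊖x] x y = trans (⊕-comm x (y ⊖ x)) (//-rightDividesˡ x y)

  shift-difference : ∀ b c g → (c ⊕ g) ⊖ (b ⊕ g) ≡ c ⊖ b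
  shift-difference b c g = ∙-cancelʳ (b ⊕ g) _ _ (begin
    ((c ⊕ g) ⊖ (b ⊕ g)) ⊕ (b ⊕ g) ≡⟨ //-rightDividesˡ (b ⊕ g) (c ⊕ g) ⟩
    c ⊕ g                         ≡⟨ cong (_⊕ g) (//-rightDividesˡ b c) ⟨
    ((c ⊖ b) ⊕ b) ⊕ g             ≡⟨ ⊕-assoc (c ⊖ b) b g ⟩
    (c ⊖ b) ⊕ (b ⊕ g)             ∎)
    where open ≡-Reasoning

-- The carrier is a range of natural numbers rather than Fin m, so that the
-- arithmetic is evaluated by Agda's built-in operations.

record Mod (m : ℕ) : Set where
  constructor mod
  field
    val    : ℕ
    .bound : val < m

open Mod public

val-injective : ∀ {m} {x y : Mod m} → val x ≡ val y → x ≡ y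
val-injective refl = refl

Fin≅Mod : ∀ m → Fin m ≅ Mod m
Fin≅Mod m .to i = mod (toℕ i) (toℕ<n i)
Fin≅Mod m .from (mod a a<m) = fromℕ< a<m
Fin≅Mod m .from-to i = fromℕ<-toℕ i (toℕ<n i)
Fin≅Mod m .to-from (mod a a<m) = val-injective (toℕ-fromℕ< a<m)

module _ {m} .{{_ : NonZero m}} where

  reduce : ℕ → Mod m
  reduce a = mod (a % m) (m%n<n a m)

  val-% : ∀ (x : Mod m) → val x % m ≡ val x
  -- The bound is irrelevant, so a usable proof of it comes from the decision procedure.
  val-% (mod a a<m) = m<n⇒m%n≡m (recompute (a ℕ.<? m) a<m)

  %-+ˡ : ∀ a b → (a % m + b) % m ≡ (a + b) % m
  %-+ˡ a b = begin
    (a % m + b) % m         ≡⟨ %-distribˡ-+ (a % m) b m ⟩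
    (a % m % m + b % m) % m ≡⟨ cong (λ c → (c + b % m) % m) (m%n%n≡m%n a m) ⟩
    (a % m + b % m) % m     ≡⟨ %-distribˡ-+ a b m ⟨
    (a + b) % m             ∎
    where open ≡-Reasoning

  %-+ʳ : ∀ a b → (a + b % m) % m ≡ (a + b) % m
  %-+ʳ a b = trans (cong (_% m) (ℕ.+-comm a (b % m))) (trans (%-+ˡ b a) (cong (_% m) (ℕ.+-comm b a)))

  cyclic : Abelian (Mod m)
  cyclic = record
    { plus  = add
    ; nil   = reduce 0
    ; minus = neg
    ; isAbelianGroup = abelianGroup add (reduce 0) neg
        (λ x y z → val-injective (trans (%-+ˡ (val x + val y) (val z))
          (trans (cong (_% m) (ℕ.+-assoc (val x) (val y) (val z))) (sym (%-+ʳ (val x) (val y + val z))))))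
        (λ x y → val-injective (cong (_% m) (ℕ.+-comm (val x) (val y))))
        (λ x → val-injective (trans (%-+ˡ 0 (val x)) (val-% x)))
        inverse }
    where
    add : Mod m → Mod m → Mod m
    add x y = reduce (val x + val y)
    neg : Mod m → Mod m
    neg x = reduce (m ∸ val x)
    inverse : ∀ x → add (neg x) x ≡ reduce 0
    inverse x@(mod a a<m) = val-injective (begin
      ((m ∸ a) % m + a) % m ≡⟨ %-+ˡ (m ∸ a) a ⟩
      (m ∸ a + a) % m       ≡⟨ cong (_% m) (ℕ.m∸n+n≡m (ℕ.<⇒≤ (recompute (a ℕ.<? m) a<m))) ⟩
      m % m                   ≡⟨ n%n≡0 m ⟩
      0                       ≡⟨ m<n⇒m%n≡m (ℕ.>-nonZero⁻¹ m) ⟨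
      0 % m                   ∎)
      where open ≡-Reasoning

  open Abelian cyclic using (_·_; nil)

  val-· : ∀ n (x : Mod m) → val (n · x) ≡ (n * val x) % m
  val-· zero    x = refl
  val-· (suc n) x = trans (cong (λ a → (val x + a) % m) (val-· n x)) (%-+ʳ (val x) (n * val x))

  m·x≡0 : ∀ q (x : Mod m) → (q * m) · x ≡ nil
  m·x≡0 q x = val-injective (begin
    val ((q * m) · x)   ≡⟨ val-· (q * m) x ⟩
    (q * m * val x) % m ≡⟨ cong (_% m) (trans (cong (_* val x) (ℕ.*-comm q m))
      (trans (ℕ.*-assoc m q (val x)) (ℕ.*-comm m (q * val x)))) ⟩
    (q * val x * m) % m ≡⟨ m*n%n≡0 (q * val x) m ⟩
    0                   ≡⟨ m<n⇒m%n≡m (ℕ.>-nonZero⁻¹ m) ⟨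
    0 % m               ∎)
    where open ≡-Reasoning

-- Invertibility of d modulo m as an equation between natural numbers, so that it can be proved by
-- the ring solver for a whole family of moduli and by search for a single one.
Unit : ℕ → ℕ → Set
Unit m d = ∃₂ λ u q → u * d ≡ 1 + q * m

module _ {m} .{{_ : NonZero m}} where
  open Abelian (cyclic {m}) using (_·_; ×-homo-+; ×-assocˡ; ×-homo-1; nil; _⊕_; ⊕-comm; identityˡ)

  unit-· : ∀ {d} ((u , _) : Unit m d) (x : Mod m) → u · (d · x) ≡ x
  unit-· {d} (u , q , u*d≡1) x = begin
    u · (d · x)             ≡⟨ ×-assocˡ x u d ⟩
    (u * d) · x             ≡⟨ cong (_· x) u*d≡1 ⟩
    (1 + q * m) · x       ≡⟨ ×-homo-+ x 1 (q * m) ⟩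
    (1 · x) ⊕ ((q * m) · x) ≡⟨ cong₂ _⊕_ (×-homo-1 x) (m·x≡0 q x) ⟩
    x ⊕ nil                 ≡⟨ ⊕-comm x nil ⟩
    nil ⊕ x                 ≡⟨ identityˡ x ⟩
    x                       ∎
    where open ≡-Reasoning

  ·-unit : ∀ {d} ((u , _) : Unit m d) (x : Mod m) → d · (u · x) ≡ x
  ·-unit {d} U@(u , _) x = trans (×-assocˡ x d u) (trans (cong (_· x) (ℕ.*-comm d u))
    (trans (sym (×-assocˡ x u d)) (unit-· U x)))

-- Truncated transversal designs

-- The points of a transversal design TD(k + 1, m): column c < k and level y, or
-- the last group, of which only x points are kept.  The block with parameters
-- a and b meets column c in a + c b and the last group in b.

module Truncated {k x z : ℕ} .{{_ : NonZero (x + z)}}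
                 (units : ∀ d → 0 < d → d < k → Unit (x + z) d) where

  private
    m : ℕ
    m = x + z

  open Abelian (cyclic {m})

  Point : Set
  Point = (Fin k × Mod m) ⊎ Fin x

  column : Point → Fin (suc k)
  column = [ suc ∘ proj₁ , (λ _ → zero) ]′

  private
    -- The slope of a block is also its point in the last group. A slope in the left summand keeps
    -- this point, a slope in the right summand loses it, so the summand decides the block size.
    slopes : (Fin x ⊎ Fin z) ≅ Mod m
    slopes .to v = to (Fin≅Mod m) (join x z v)
    slopes .from b = splitAt x (from (Fin≅Mod m) b)
    slopes .from-to v = trans (cong (splitAt x) (from-to (Fin≅Mod m) (join x z v))) (splitAt-join x z v)
    slopes .to-from b = trans (cong (to (Fin≅Mod m)) (join-splitAt x z _)) (to-from (Fin≅Mod m) b)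

    Blk : Set
    Blk = Mod m × (Fin x ⊎ Fin z)

    level : Blk → Fin k → Mod m
    level (a , v) c = a ⊕ (toℕ c · to slopes v)

    blk-size : Blk → ℕ
    blk-size (_ , inj₁ _) = suc k
    blk-size (_ , inj₂ _) = k

    pt : ∀ b → Fin (blk-size b) → Point
    pt   (_ , inj₁ s) zero    = inj₂ s
    pt b@(_ , inj₁ _) (suc c) = inj₁ (c , level b c)
    pt b@(_ , inj₂ _) c       = inj₁ (c , level b c)

    -- Incidence without positions: in a column it reads the same for both block sizes, so the
    -- geometry needs no case distinction on them.
    On : Blk → Point → Set
    On b       (inj₁ (c , y)) = level b c ≡ y
    On (_ , v) (inj₂ s)       = v ≡ inj₁ s

    on : ∀ b i → On b (pt b i)
    on (_ , inj₁ _) zero    = refl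
    on (_ , inj₁ _) (suc _) = refl
    on (_ , inj₂ _) _       = refl

    position : ∀ b p → On b p → ∃ λ i → pt b i ≡ p
    position (_ , inj₁ _) (inj₁ (c , _)) refl = suc c , refl
    position (_ , inj₂ _) (inj₁ (c , _)) refl = c , refl
    position (_ , inj₁ _) (inj₂ _)       refl = zero , refl

    pt-transversal : ∀ b {i j} → column (pt b i) ≡ column (pt b j) → i ≡ j
    pt-transversal (_ , inj₁ _) {zero}  {zero}  _  = refl
    pt-transversal (_ , inj₁ _) {suc _} {suc _} eq = eq
    pt-transversal (_ , inj₂ _) eq = suc-injective eq

    -- Column distances lie strictly between 0 and k, which is exactly where `units` supplies
    -- inverses; dividing by them recovers a slope from two levels.
    gap : ∀ {c c′ : Fin k} → toℕ c < toℕ c′ → ∃ λ d → toℕ c + d ≡ toℕ c′ × Unit m d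
    gap {c} {c′} c<c′ = toℕ c′ ∸ toℕ c , ℕ.m+[n∸m]≡n (ℕ.<⇒≤ c<c′) ,
      units _ (ℕ.m<n⇒0<n∸m c<c′) (ℕ.≤-<-trans (ℕ.m∸n≤m (toℕ c′) (toℕ c)) (toℕ<n c′))

    Meet : Point → Point → Set
    Meet p q = ∃ λ b → On b p × On b q

    swap-meet : ∀ p q → Meet p q → Meet q p
    swap-meet p q (b , on-p , on-q) = b , on-q , on-p

    through : ∀ c y β → On (y ⊖ (toℕ c · β) , from slopes β) (inj₁ (c , y))
    through c y β = trans (cong (λ β′ → (y ⊖ (toℕ c · β)) ⊕ (toℕ c · β′)) (to-from slopes β))
                          (//-rightDividesˡ (toℕ c · β) y)

    level-⊕ : ∀ a {c c′ d} → c + d ≡ c′ → ∀ β → a ⊕ (c′ · β) ≡ (a ⊕ (c · β)) ⊕ (d · β)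
    level-⊕ a {c} {_} {d} refl β = trans (cong (a ⊕_) (×-homo-+ β c d)) (sym (⊕-assoc a (c · β) (d · β)))

    meet-columns : ∀ {c c′ y y′} → toℕ c < toℕ c′ → Meet (inj₁ (c , y)) (inj₁ (c′ , y′))
    meet-columns {c} {c′} {y} {y′} c<c′ with d , c+d≡c′ , U@(u , _) ← gap c<c′ = b , through c y β , (begin
      a ⊕ (toℕ c′ · to slopes v)               ≡⟨ level-⊕ a {toℕ c} {d = d} c+d≡c′ (to slopes v) ⟩
      level b c ⊕ (d · to slopes v)            ≡⟨ cong₂ _⊕_ (through c y β)
        (cong (d ·_) (to-from slopes β)) ⟩
      y ⊕ (d · (u · (y′ ⊖ y)))                 ≡⟨ cong (y ⊕_) (·-unit U (y′ ⊖ y)) ⟩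
      y ⊕ (y′ ⊖ y)                             ≡⟨ x⊕[y⊖x] y y′ ⟩
      y′                                       ∎)
      where
      open ≡-Reasoning
      -- The rise from y to y′ divided by the column distance d.
      β = u · (y′ ⊖ y)
      a = y ⊖ (toℕ c · β)
      v = from slopes β
      b = a , v

    meet-last : ∀ c y s → Meet (inj₁ (c , y)) (inj₂ s)
    meet-last c y s = (y ⊖ (toℕ c · to slopes (inj₁ s)) , from slopes (to slopes (inj₁ s))) ,
      through c y (to slopes (inj₁ s)) , from-to slopes (inj₁ s)

    meet : ∀ p q → column p ≢ column q → Meet p q
    meet p@(inj₁ (c , _)) q@(inj₁ (c′ , _)) p≢q with ℕ.<-cmp (toℕ c) (toℕ c′)
    ... | tri< c<c′ _ _ = meet-columns c<c′
    ... | tri> _ _ c>c′ = swap-meet q p (meet-columns c>c′)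
    ... | tri≈ _ c≡c′ _ = contradiction (cong suc (toℕ-injective c≡c′)) p≢q
    meet (inj₁ (c , y)) (inj₂ s) _ = meet-last c y s
    meet p@(inj₂ s) q@(inj₁ (c , y)) _ = swap-meet q p (meet-last c y s)
    meet (inj₂ _) (inj₂ _) p≢q = contradiction refl p≢q

    same-slope : ∀ {b b′ c y} → proj₂ b ≡ proj₂ b′ → On b (inj₁ (c , y)) → On b′ (inj₁ (c , y)) → b ≡ b′
    same-slope {_ , v} {c = c} refl p p′ = cong (_, v) (∙-cancelʳ (toℕ c · to slopes v) _ _
      (trans p (sym p′)))

    same-columns : ∀ {b b′ c c′ y y′} → toℕ c < toℕ c′ →
                   On b (inj₁ (c , y)) → On b (inj₁ (c′ , y′)) →
                   On b′ (inj₁ (c , y)) → On b′ (inj₁ (c′ , y′)) → b ≡ b′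
    same-columns {b@(a , v)} {b′@(a′ , v′)} {c} {c′} {y} {y′} c<c′ p q p′ q′
      with d , c+d≡c′ , U@(u , _) ← gap c<c′ =
      same-slope {b} {b′} {c} v≡v′ p p′
      where
      open ≡-Reasoning
      rise : ∀ {a v} → On (a , v) (inj₁ (c , y)) → On (a , v) (inj₁ (c′ , y′)) → d · to slopes v ≡ y′ ⊖ y
      rise {a} {v} p q = begin
        d · to slopes v                           ≡⟨ x⊕y⊖x y (d · to slopes v) ⟨
        (y ⊕ (d · to slopes v)) ⊖ y               ≡⟨ cong (λ l → (l ⊕ (d · to slopes v)) ⊖ y) p ⟨
        (level (a , v) c ⊕ (d · to slopes v)) ⊖ y ≡⟨ cong (_⊖ y)
          (level-⊕ a {toℕ c} {d = d} c+d≡c′ (to slopes v)) ⟨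
        level (a , v) c′ ⊖ y                      ≡⟨ cong (_⊖ y) q ⟩
        y′ ⊖ y                                    ∎
      v≡v′ : v ≡ v′
      v≡v′ = begin
        v                                   ≡⟨ from-to slopes v ⟨
        from slopes (to slopes v)           ≡⟨ cong (from slopes) (unit-· U (to slopes v)) ⟨
        from slopes (u · (d · to slopes v)) ≡⟨ cong (λ e → from slopes (u · e))
          (trans (rise {a} {v} p q) (sym (rise {a′} {v′} p′ q′))) ⟩
        from slopes (u · (d · to slopes v′)) ≡⟨ cong (from slopes) (unit-· U (to slopes v′)) ⟩
        from slopes (to slopes v′)          ≡⟨ from-to slopes v′ ⟩
        v′                                  ∎

    same : ∀ b b′ p q → column p ≢ column q → On b p → On b q → On b′ p → On b′ q → b ≡ b′
    same b b′ (inj₁ (c , _)) (inj₁ (c′ , _)) p≢q p q p′ q′ with ℕ.<-cmp (toℕ c) (toℕ c′)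
    ... | tri< c<c′ _ _ = same-columns {b} {b′} c<c′ p q p′ q′
    ... | tri> _ _ c>c′ = same-columns {b} {b′} c>c′ q p q′ p′
    ... | tri≈ _ c≡c′ _ = contradiction (cong suc (toℕ-injective c≡c′)) p≢q
    same b b′ (inj₁ (c , _)) (inj₂ _) _ p q p′ q′ = same-slope {b} {b′} {c} (trans q (sym q′)) p p′
    same b b′ (inj₂ _) (inj₁ (c , _)) _ p q p′ q′ = same-slope {b} {b′} {c} (trans p (sym p′)) q q′
    same b b′ (inj₂ _) (inj₂ _) p≢q _ _ _ _ = contradiction refl p≢q

  truncated : ∀ {K : ℕ → Set} → K k → K (suc k) → GroupDivisible column K
  truncated Kk Ksk = record
    { Block       = Blk
    ; size        = blk-size
    ; size-K      = λ { (_ , inj₁ _) → Ksk ; (_ , inj₂ _) → Kk }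
    ; point       = pt
    ; transversal = pt-transversal
    ; common      = λ {p} {q} p≢q → case meet p q p≢q of λ (b , on-p , on-q) →
        case (position b p on-p , position b q on-q) of λ ((i , eqᵢ) , (j , eqⱼ)) → b , i , j , eqᵢ , eqⱼ
    ; unique      = λ {b} {b′} {i} {j} {i′} {j′} i≢j p q →
        same b b′ (pt b i) (pt b j) (i≢j ∘ pt-transversal b) (on b i) (on b j)
             (subst (On b′) (sym p) (on b′ i′)) (subst (On b′) (sym q) (on b′ j′))
    }

-- Difference families

AllPairs-injective : ∀ {A B : Set} {f : A → B} {xs} → AllPairs (λ x y → f x ≢ f y) xs →
                     ∀ {x y} → x ∈ˡ xs → y ∈ˡ xs → f x ≡ f y → x ≡ y
AllPairs-injective (_ ∷ _)  (here refl) (here refl) _  = refl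
AllPairs-injective (≢xs ∷ _) (here refl) (there y∈)  eq = contradiction eq (All.lookup ≢xs y∈)
AllPairs-injective (≢xs ∷ _) (there x∈)  (here refl) eq = contradiction (sym eq) (All.lookup ≢xs x∈)
AllPairs-injective (_ ∷ ps) (there x∈)  (there y∈)  eq = AllPairs-injective ps x∈ y∈ eq

-- Base blocks in A whose differences cover the complement of the kernel of φ
-- exactly once; their translates form a design on A with the cosets of the
-- kernel as groups.

module DifferenceFamily {A Q : Set} (𝔸 : Abelian A) (ℚ : Abelian Q) (φ : A → Q)
                        (base : List (List A)) where
  open Abelian 𝔸
  private module Q = Abelian ℚ

  Key : Set
  Key = Σ (Fin (length base)) λ t → Fin (length (lookup base t)) × Fin (length (lookup base t))

  entry : ∀ t → Fin (length (lookup base t)) → A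
  entry t = lookup (lookup base t)

  difference : Key → A
  difference (t , i , j) = entry t j ⊖ entry t i

  keys : List Key
  keys = concatMap (λ t → map (t ,_) (filter (λ (i , j) → ¬? (i Fin.≟ j))
    (cartesianProduct (allFin _) (allFin _)))) (allFin (length base))

  ∈-keys : ∀ t {i j} → i ≢ j → (t , i , j) ∈ˡ keys
  ∈-keys t {i} {j} i≢j = ∈-concatMap⁺ _ (lose (∈-allFin t) (∈-map⁺ (t ,_)
    (∈-filter⁺ (λ (i , j) → ¬? (i Fin.≟ j)) (∈-cartesianProduct⁺ (∈-allFin i) (∈-allFin j)) i≢j)))

  differences : List A
  differences = map difference keys

  -- Three finite checks, one for each law of the developed design: `proper` makes blocks
  -- transversal to the cosets, `covering` yields a common block, `distinct` its uniqueness.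
  record Perfect (elements : List A) : Set where
    field
      proper   : All (λ d → φ d ≢ Q.nil) differences
      distinct : Unique differences
      covering : All (λ d → φ d ≢ Q.nil → d ∈ˡ differences) elements

  perfect? : DecidableEquality A → DecidableEquality Q → ∀ elements → Dec (Perfect elements)
  perfect? _≟A_ _≟Q_ elements = map′
    (λ (p , d , c) → record { proper = p ; distinct = d ; covering = c })
    (λ P → let open Perfect P in proper , distinct , covering)
    (all? (λ d → ¬? (φ d ≟Q Q.nil)) differences
      ×-dec allPairs? (λ d d′ → ¬? (d ≟A d′)) differences
      ×-dec all? (λ d → ¬? (φ d ≟Q Q.nil) →-dec any? (d ≟A_) differences) elements)

  module _ (φ-⊕ : ∀ x y → φ (x ⊕ y) ≡ φ x Q.⊕ φ y) where

    φ-step : ∀ x y → φ y ≡ φ x Q.⊕ φ (y ⊖ x)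
    φ-step x y = trans (cong φ (sym (x⊕[y⊖x] x y))) (φ-⊕ x (y ⊖ x))

    φ≡⇒kernel : ∀ {x y} → φ x ≡ φ y → φ (y ⊖ x) ≡ Q.nil
    φ≡⇒kernel {x} {y} eq = Q.∙-cancelˡ (φ x) _ _
      (trans (sym (φ-step x y)) (trans (sym eq) (sym (Q.identityʳ (φ x)))))

    kernel⇒φ≡ : ∀ {x y} → φ (y ⊖ x) ≡ Q.nil → φ x ≡ φ y
    kernel⇒φ≡ {x} {y} eq = sym (trans (φ-step x y) (trans (cong (φ x Q.⊕_) eq) (Q.identityʳ (φ x))))

    develop : ∀ {K elements} → (∀ x → x ∈ˡ elements) → All (K ∘ length) base →
              Perfect elements → GroupDivisible φ K
    develop {K} complete sizes perfect = record
      { Block       = Fin (length base) × A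
      ; size        = λ (t , _) → length (lookup base t)
      ; size-K      = λ (t , _) → All.lookup sizes (∈-lookup t)
      ; point       = pt
      ; transversal = transv
      ; common      = joint
      ; unique      = λ {b} {b′} → uniq b b′
      }
      where
      open Perfect perfect

      pt : ((t , a) : Fin (length base) × A) → Fin (length (lookup base t)) → A
      pt (t , a) i = entry t i ⊕ a

      transv : ∀ b {i j} → φ (pt b i) ≡ φ (pt b j) → i ≡ j
      transv (t , a) {i} {j} eq = decidable-stable (i Fin.≟ j) λ i≢j →
        All.lookup proper (∈-map⁺ difference (∈-keys t i≢j))
          (trans (cong φ (sym (shift-difference (entry t i) (entry t j) a))) (φ≡⇒kernel eq))

      joint : ∀ {x y} → φ x ≢ φ y → Σ (Fin (length base) × A) λ b → ∃₂ λ i j → pt b i ≡ x × pt b j ≡ y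
      joint {x} {y} φx≢φy =
        let (t , i , j) , _ , ≡δ = ∈-map⁻ difference (All.lookup covering (complete (y ⊖ x))
              (φx≢φy ∘ kernel⇒φ≡))
            open ≡-Reasoning
        -- The translation taking `entry t i` to x takes `entry t j` to y, because the difference of
        -- the two entries is y - x.
        in (t , x ⊖ entry t i) , i , j , x⊕[y⊖x] (entry t i) x , (begin
          entry t j ⊕ (x ⊖ entry t i)                               ≡⟨ cong (_⊕ (x ⊖ entry t i))
            (//-rightDividesˡ (entry t i) (entry t j)) ⟨
          ((entry t j ⊖ entry t i) ⊕ entry t i) ⊕ (x ⊖ entry t i)   ≡⟨ ⊕-assoc _ _ _ ⟩
          (entry t j ⊖ entry t i) ⊕ (entry t i ⊕ (x ⊖ entry t i))   ≡⟨ cong₂ _⊕_ (sym ≡δ)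
            (x⊕[y⊖x] (entry t i) x) ⟩
          (y ⊖ x) ⊕ x                                               ≡⟨ //-rightDividesˡ x y ⟩
          y                                                         ∎)

      uniq : ∀ b b′ {i j i′ j′} → i ≢ j → pt b i ≡ pt b′ i′ → pt b j ≡ pt b′ j′ → b ≡ b′
      -- Translation preserves differences, so both pairs of positions give the same difference and
      -- hence are the same key; cancelling the entry leaves equal translations.
      uniq (t , a) (t′ , a′) {i} {j} {i′} {j′} i≢j p q = same-key
        (AllPairs-injective (AllPairs.map⁻ distinct) (∈-keys t i≢j) (∈-keys t′ i′≢j′)
          (trans (sym (shift-difference (entry t i) (entry t j) a))
          (trans (cong₂ _⊖_ q p) (shift-difference (entry t′ i′) (entry t′ j′) a′))))
        p
        where
        i′≢j′ : i′ ≢ j′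
        i′≢j′ refl = i≢j (transv (t , a) (cong φ (trans p (sym q))))
        same-key : ∀ {t t′ i j i′ j′} → _≡_ {A = Key} (t , i , j) (t′ , i′ , j′) →
                   pt (t , a) i ≡ pt (t′ , a′) i′ → (t , a) ≡ (t′ , a′)
        same-key {t} {i = i} refl p = cong (t ,_) (∙-cancelˡ (entry t i) _ _ p)

_≟ᴹ_ : ∀ {m} → DecidableEquality (Mod m)
x ≟ᴹ y = map′ val-injective (cong val) (val x ℕ.≟ val y)

module _ {m} .{{_ : NonZero m}} where

  residues : List (Mod m)
  residues = map reduce (upTo m)

  ∈-residues : ∀ x → x ∈ˡ residues
  ∈-residues x@(mod a a<m) = subst (_∈ˡ residues) (val-injective (val-% x))
    (∈-map⁺ reduce (∈-upTo⁺ (recompute (a ℕ.<? m) a<m)))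

module Projection (h u : ℕ) .{{_ : NonZero u}} .{{_ : NonZero (h * u)}} where

  private
    module V = Abelian (cyclic {h * u})
    module U = Abelian (cyclic {u})

  project : Mod (h * u) → Mod u
  project x = reduce (val x)

  project-⊕ : ∀ x y → project (x V.⊕ y) ≡ project x U.⊕ project y
  project-⊕ x y = val-injective (trans (m∣n⇒o%n%m≡o%m u (h * u) (val x + val y) (divides h refl))
                                       (%-distribˡ-+ (val x) (val y) u))

  lift : Mod u → Fin h → Mod (h * u)
  lift (mod a a<u) i = mod (toℕ i * u + a) (begin-strict
    toℕ i * u + a <⟨ ℕ.+-monoʳ-< (toℕ i * u) a<u ⟩
    toℕ i * u + u ≡⟨ ℕ.+-comm (toℕ i * u) u ⟩
    suc (toℕ i) * u ≤⟨ ℕ.*-monoˡ-≤ u (toℕ<n i) ⟩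
    h * u           ∎)
    where open ℕ.≤-Reasoning

  project-lift : ∀ γ i → project (lift γ i) ≡ γ
  project-lift γ@(mod a _) i = val-injective (trans (cong (_% u) (ℕ.+-comm (toℕ i * u) a))
    (trans ([m+kn]%n≡m%n a (toℕ i) u) (val-% γ)))

  lift-injective : ∀ γ {i j} → lift γ i ≡ lift γ j → i ≡ j
  lift-injective γ {i} {j} eq = toℕ-injective (ℕ.*-cancelʳ-≡ (toℕ i) (toℕ j) u
    (ℕ.+-cancelʳ-≡ (val γ) _ _ (cong val eq)))

  quotient : Mod (h * u) → Fin h
  quotient (mod a a<hu) = fromℕ< (m<n*o⇒m/o<n {a} {h} {u} a<hu)

  lift-project : ∀ x → lift (project x) (quotient x) ≡ x
  lift-project (mod a a<hu) = val-injective (trans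
    (cong (λ q → q * u + a % u) (toℕ-fromℕ< (m<n*o⇒m/o<n {a} {h} {u} a<hu)))
    (trans (ℕ.+-comm (a / u * u) (a % u)) (sym (m≡m%n+[m/n]*n a u))))

-- Asking only for the Boolean to be `true` lets `refl` check a large decision without normalising
-- its proof.
witness : ∀ {A : Set} (a? : Dec A) → does a? ≡ true → A
witness (yes a) refl = a

-- Bijections between finite types

≅-refl : ∀ {X} → X ≅ X
≅-refl = iso id id (λ _ → refl) (λ _ → refl)

≅-trans : ∀ {X Y Z} → X ≅ Y → Y ≅ Z → X ≅ Z
≅-trans f g = iso (to g ∘ to f) (from f ∘ from g)
  (λ x → trans (cong (from f) (from-to g (to f x))) (from-to f x))
  (λ z → trans (cong (to g) (to-from f (from g z))) (to-from g z))

≅-sym : ∀ {X Y} → X ≅ Y → Y ≅ X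
≅-sym f = iso (from f) (to f) (to-from f) (from-to f)

_⊎-≅_ : ∀ {X X′ Y Y′} → X ≅ X′ → Y ≅ Y′ → (X ⊎ Y) ≅ (X′ ⊎ Y′)
f ⊎-≅ g = iso (Sum.map (to f) (to g)) (Sum.map (from f) (from g))
  (λ { (inj₁ x) → cong inj₁ (from-to f x) ; (inj₂ y) → cong inj₂ (from-to g y) })
  (λ { (inj₁ x) → cong inj₁ (to-from f x) ; (inj₂ y) → cong inj₂ (to-from g y) })

_×-≅_ : ∀ {X X′ Y Y′} → X ≅ X′ → Y ≅ Y′ → (X × Y) ≅ (X′ × Y′)
f ×-≅ g = iso (λ (x , y) → to f x , to g y) (λ (x , y) → from f x , from g y)
  (λ (x , y) → cong₂ _,_ (from-to f x) (from-to g y))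
  (λ (x , y) → cong₂ _,_ (to-from f x) (to-from g y))

Fin-⊎ : ∀ {m n} → (Fin m ⊎ Fin n) ≅ Fin (m + n)
Fin-⊎ {m} {n} = iso (join m n) (splitAt m) (splitAt-join m n) (join-splitAt m n)

Fin-× : ∀ {m n} → (Fin m × Fin n) ≅ Fin (m * n)
Fin-× {m} {n} = iso (λ (i , j) → combine i j) (remQuot n) (λ (i , j) → remQuot-combine i j)
  (combine-remQuot {m} n)

-- The designs of the recursion

-- FourGDD r states that a 5-GDD of type 4^r exists, equivalently a (4r + 1, 5, 1)-BIBD.

FourGDD : ℕ → Set₁
FourGDD r = GroupDivisible {Fin r × Fin 4} proj₁ (_≡ 5)

-- The block sizes to which the induction hypothesis applies. Sizes 0 and 1 are included, so a
-- column that truncation leaves empty or with a single point is filled like any other.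
Smaller : ℕ → ℕ → Set
Smaller r k = k < r × k % 5 ≤ 1

fromSteiner : ∀ r → PairwiseBalanced (Fin (suc (r * 4))) (_≡ 5) → FourGDD r
fromSteiner r D = delete D r refl

toSteiner : ∀ {r} → FourGDD r → PairwiseBalanced (Fin (r * 4 + 1)) (_≡ 5)
toSteiner D = relabelPoints (≅-trans (Fin-× ⊎-≅ ≅-refl) Fin-⊎)
  (fill Fin._≟_ D (s≤s z≤n) (λ _ → 4) _,_ (λ _ → ,-injectiveʳ) (λ _ _ → refl) (λ (_ , a) → a , refl)
    (λ _ → refl))

fillTruncated : ∀ {K k x z w} .{{_ : NonZero (x + z)}} →
                (∀ d → 0 < d → d < k → Unit (x + z) d) → w ≤ 1 →
                K k → K (suc k) → K ((x + z) + w) → K (x + w) →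
                PairwiseBalanced (Fin (k * (x + z) + x + w)) K
fillTruncated {K} {k} {x} {z} {w} units w≤1 Kk Ksk Kmw Kxw =
  relabelPoints (≅-trans (≅-trans ((≅-refl ×-≅ ≅-sym (Fin≅Mod (x + z))) ⊎-≅ ≅-refl)
                                  (≅-trans (Fin-× ⊎-≅ ≅-refl) Fin-⊎) ⊎-≅ ≅-refl) Fin-⊎)
    (fill Fin._≟_ (truncated {K} Kk Ksk) w≤1 group-size ι ι-injective ι-column ι-onto
      (λ { zero → Kxw ; (suc _) → Kmw }))
  where
  open Truncated {k} {x} {z} units

  group-size : Fin (suc k) → ℕ
  group-size zero    = x
  group-size (suc _) = x + z

  ι : ∀ γ → Fin (group-size γ) → Point
  ι zero    s = inj₂ s
  ι (suc c) i = inj₁ (c , to (Fin≅Mod (x + z)) i)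

  ι-injective : ∀ γ {i j} → ι γ i ≡ ι γ j → i ≡ j
  ι-injective zero    eq = inj₂-injective eq
  ι-injective (suc c) {i} {j} eq = trans (sym (from-to (Fin≅Mod (x + z)) i))
    (trans (cong (from (Fin≅Mod (x + z))) (,-injectiveʳ (inj₁-injective eq))) (from-to (Fin≅Mod (x + z)) j))

  ι-column : ∀ γ i → column (ι γ i) ≡ γ
  ι-column zero    _ = refl
  ι-column (suc _) _ = refl

  ι-onto : ∀ p → ∃ λ i → ι (column p) i ≡ p
  ι-onto (inj₁ (c , y)) = from (Fin≅Mod (x + z)) y , cong (λ y → inj₁ (c , y)) (to-from (Fin≅Mod (x + z)) y)
  ι-onto (inj₂ s) = s , refl

-- Direct constructions from difference families

-- The first list is a group of multipliers of the family, the second one holds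
-- representatives of its orbits on the base blocks.

multiples : ∀ {v} .{{_ : NonZero v}} → List ℕ → List (List ℕ) → List (List (Mod v))
multiples = cartesianProductWith (λ m → map (λ x → reduce (m * x)))

module Cyclic (h u : ℕ) .{{_ : NonZero u}} .{{_ : NonZero (h * u)}} (base : List (List (Mod (h * u)))) where

  open Projection h u
  open DifferenceFamily (cyclic {h * u}) (cyclic {u}) project base

  isPerfect? : Dec (Perfect residues)
  isPerfect? = perfect? _≟ᴹ_ _≟ᴹ_ residues

  module _ {K : ℕ → Set} (K? : Decidable K)
           (valid : does (all? (K? ∘ length) base ×-dec isPerfect?) ≡ true) where

    design : GroupDivisible project K
    design =
      let sizes , perfect = witness (all? (K? ∘ length) base ×-dec isPerfect?) valid
      in develop project-⊕ ∈-residues sizes perfect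

    filled : ∀ {w} → w ≤ 1 → K (h + w) → PairwiseBalanced (Fin (h * u + w)) K
    filled w≤1 Khw = relabelPoints (≅-trans (≅-sym (Fin≅Mod (h * u)) ⊎-≅ ≅-refl) Fin-⊎)
      (fill _≟ᴹ_ design w≤1 (λ _ → h) lift lift-injective project-lift
        (λ x → quotient x , lift-project x) (λ _ → Khw))

    uniform : GroupDivisible {Fin u × Fin h} proj₁ K
    uniform = relabel design
      (≅-trans (iso (λ x → project x , quotient x) (λ (γ , i) → lift γ i) lift-project
         (λ (γ , i) → cong₂ _,_ (project-lift γ i) (lift-injective γ
           (trans (cong (λ γ′ → lift γ′ (quotient (lift γ i))) (sym (project-lift γ i)))
             (lift-project (lift γ i))))))
       (≅-sym (Fin≅Mod u) ×-≅ ≅-refl))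
      (cong (from (Fin≅Mod u)))
      (λ {x} {y} eq → trans (sym (to-from (Fin≅Mod u) (project x)))
        (trans (cong (to (Fin≅Mod u)) eq) (to-from (Fin≅Mod u) (project y))))

    ungrouped : (∀ (i j : Fin h) → i ≡ j) → PairwiseBalanced (Fin (h * u)) K
    ungrouped irr = relabel design (≅-sym (Fin≅Mod (h * u)))
      (λ {x} {y} eq → cong (from (Fin≅Mod (h * u))) (trans (sym (lift-project x))
        (trans (cong₂ lift eq (irr (quotient x) (quotient y))) (lift-project y))))
      (λ {x} {y} eq → cong project (trans (sym (to-from (Fin≅Mod (h * u)) x))
        (trans (cong (to (Fin≅Mod (h * u))) eq) (to-from (Fin≅Mod (h * u)) y))))

five? : ∀ k → Dec (k ≡ 5)
five? k = k ℕ.≟ 5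

smaller? : ∀ r k → Dec (Smaller r k)
smaller? r k = k ℕ.<? r ×-dec k % 5 ℕ.≤? 1

fromDifferences : ∀ r .{{_ : NonZero (1 * suc (r * 4))}} (base : List (List (Mod (1 * suc (r * 4))))) →
                  does (all? (five? ∘ length) base ×-dec Cyclic.isPerfect? 1 (suc (r * 4)) base)
                    ≡ true → FourGDD r
fromDifferences r base valid = fromSteiner r (subst (λ v → PairwiseBalanced (Fin v) (_≡ 5))
  (ℕ.*-identityˡ (suc (r * 4)))
  (Cyclic.ungrouped 1 (suc (r * 4)) base five? valid (Fin-irrelevant (s≤s z≤n))))

-- A base block of size 5 has 20 differences, but for r ≡ 1 (mod 5) the number 4 r of nonzero
-- residues is not divisible by 20. The cosets of the subgroup of order 5 are taken as blocks, which
-- leaves 4 r - 4 differences to cover.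
fromGroupedDifferences : ∀ r u .{{_ : NonZero u}} .{{_ : NonZero (5 * u)}} → 5 * u + 0 ≡ suc (r * 4) →
                         (base : List (List (Mod (5 * u)))) →
                         does (all? (five? ∘ length) base ×-dec Cyclic.isPerfect? 5 u base) ≡ true →
                           FourGDD r
fromGroupedDifferences r u v≡ base valid = fromSteiner r (subst (λ v → PairwiseBalanced (Fin v) (_≡ 5)) v≡
  (Cyclic.filled 5 u base five? valid z≤n refl))

fourGDD-0 : FourGDD 0
fourGDD-0 = record
  { Block = Fin 0 ; size = λ () ; size-K = λ () ; point = λ () ; transversal = λ ()
  ; common = λ { {() , _} } ; unique = λ { {()} } }

fourGDD-1 : FourGDD 1
fourGDD-1 = record
  { Block = Fin 0 ; size = λ () ; size-K = λ () ; point = λ () ; transversal = λ ()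
  ; common = λ { {zero , _} {zero , _} 0≢0 → contradiction refl 0≢0 } ; unique = λ { {()} } }

-- The affine plane of order 5 without a point.

fourGDD-6 : FourGDD 6
fourGDD-6 = Cyclic.uniform 4 6 (multiples (1 ∷ []) ((0 ∷ 1 ∷ 3 ∷ 11 ∷ 20 ∷ []) ∷ [])) five? refl

_⊗_ : ∀ {A B} → Abelian A → Abelian B → Abelian (A × B)
𝔸 ⊗ 𝔹 = record
  { plus  = λ (a , b) (a′ , b′) → a A.⊕ a′ , b B.⊕ b′
  ; nil   = A.nil , B.nil
  ; minus = λ (a , b) → A.minus a , B.minus b
  ; isAbelianGroup = abelianGroup _ _ _
      (λ (a , b) (a′ , b′) (a″ , b″) → cong₂ _,_ (A.⊕-assoc a a′ a″) (B.⊕-assoc b b′ b″))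
      (λ (a , b) (a′ , b′) → cong₂ _,_ (A.⊕-comm a a′) (B.⊕-comm b b′))
      (λ (a , b) → cong₂ _,_ (A.identityˡ a) (B.identityˡ b))
      (λ (a , b) → cong₂ _,_ (A.inverseˡ a) (B.inverseˡ b)) }
  where
  module A = Abelian 𝔸
  module B = Abelian 𝔹

-- There is no cyclic (45, 5, 1) difference family; this one lives on ℤ/3 × ℤ/15.

fourGDD-11 : FourGDD 11
fourGDD-11 = fromSteiner 11 (relabelPoints (≅-trans ((≅-sym (Fin≅Mod 3) ×-≅ ≅-sym (Fin≅Mod 15)) ⊎-≅ ≅-refl)
                                               (≅-trans (Fin-× ⊎-≅ ≅-refl) Fin-⊎))
  (fill _≟Q_ design z≤n (λ _ → 5) (λ (α , γ) i → α , lift γ i)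
    (λ (_ , γ) eq → lift-injective γ (,-injectiveʳ eq))
    (λ (α , γ) i → cong (α ,_) (project-lift γ i))
    (λ (α , x) → quotient x , cong (α ,_) (lift-project x))
    (λ _ → refl)))
  where
  open Projection 5 3

  _≟Q_ : DecidableEquality (Mod 3 × Mod 3)
  _≟Q_ = ≡-dec _≟ᴹ_ _≟ᴹ_

  φ : Mod 3 × Mod 15 → Mod 3 × Mod 3
  φ (α , x) = α , project x

  base : List (List (Mod 3 × Mod 15))
  base = (pt 0 10 ∷ pt 0 5 ∷ pt 1 12 ∷ pt 2 12 ∷ pt 0 6 ∷ [])
       ∷ (pt 2 10 ∷ pt 1 5 ∷ pt 2 2 ∷ pt 1 7 ∷ pt 0 6 ∷ []) ∷ []
    where
    pt : ℕ → ℕ → Mod 3 × Mod 15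
    pt a b = reduce a , reduce b

  open DifferenceFamily (cyclic {3} ⊗ cyclic {15}) (cyclic {3} ⊗ cyclic {3}) φ base

  elements : List (Mod 3 × Mod 15)
  elements = cartesianProduct residues residues

  design : GroupDivisible φ (_≡ 5)
  design = develop (λ (α , x) (β , y) → cong ((Abelian._⊕_ cyclic α β) ,_) (project-⊕ x y))
    (λ (α , x) → ∈-cartesianProduct⁺ (∈-residues α) (∈-residues x)) (refl ∷ refl ∷ [])
    (witness (perfect? (≡-dec _≟ᴹ_ _≟ᴹ_) _≟Q_ elements) refl)

-- A planar difference set modulo 21, invariant under doubling: the projective plane of order 4.
-- Without a point it is a TD(5, 4).
fourGDD-5 : FourGDD 5
fourGDD-5 = fromDifferences 5 (multiples (1 ∷ [])
  ((3 ∷ 6 ∷ 7 ∷ 12 ∷ 14 ∷ []) ∷ [])) refl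

fourGDD-10 : FourGDD 10
fourGDD-10 = fromDifferences 10 (multiples (1 ∷ [])
  ((0 ∷ 1 ∷ 4 ∷ 11 ∷ 29 ∷ []) ∷ (0 ∷ 2 ∷ 8 ∷ 17 ∷ 22 ∷ []) ∷ [])) refl

fourGDD-15 : FourGDD 15
fourGDD-15 = fromDifferences 15 (multiples (1 ∷ [])
  ((0 ∷ 28 ∷ 1 ∷ 4 ∷ 44 ∷ []) ∷ (0 ∷ 11 ∷ 5 ∷ 19 ∷ 31 ∷ []) ∷ (0 ∷ 2 ∷ 9 ∷ 38 ∷ 48 ∷ []) ∷ [])) refl

fourGDD-16 : FourGDD 16
fourGDD-16 = fromGroupedDifferences 16 13 refl (multiples (1 ∷ [])
  ((0 ∷ 30 ∷ 2 ∷ 44 ∷ 64 ∷ []) ∷ (0 ∷ 4 ∷ 10 ∷ 19 ∷ 57 ∷ []) ∷ (0 ∷ 5 ∷ 16 ∷ 41 ∷ 48 ∷ []) ∷ [])) refl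

fourGDD-20 : FourGDD 20
fourGDD-20 = fromDifferences 20 (multiples (1 ∷ [])
  ((0 ∷ 25 ∷ 33 ∷ 55 ∷ 28 ∷ []) ∷ (0 ∷ 19 ∷ 2 ∷ 37 ∷ 69 ∷ []) ∷ (0 ∷ 21 ∷ 34 ∷ 41 ∷ 45 ∷ []) ∷
   (0 ∷ 1 ∷ 10 ∷ 16 ∷ 39 ∷ []) ∷ [])) refl

fourGDD-35 : FourGDD 35
fourGDD-35 = fromDifferences 35 (multiples (1 ∷ [])
  ((0 ∷ 31 ∷ 81 ∷ 24 ∷ 90 ∷ []) ∷ (0 ∷ 21 ∷ 4 ∷ 69 ∷ 58 ∷ []) ∷ (0 ∷ 68 ∷ 25 ∷ 53 ∷ 139 ∷ []) ∷
   (0 ∷ 26 ∷ 67 ∷ 6 ∷ 29 ∷ []) ∷ (0 ∷ 42 ∷ 8 ∷ 30 ∷ 136 ∷ []) ∷ (0 ∷ 36 ∷ 46 ∷ 85 ∷ 125 ∷ []) ∷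
   (0 ∷ 14 ∷ 32 ∷ 33 ∷ 77 ∷ []) ∷ [])) refl

-- The multipliers are 1 modulo 5 and form the subgroup of order 7 modulo 29; the 7 images of one
-- block have the 140 differences outside the subgroup of order 5. Orders 46 and 51 follow the same
-- pattern modulo 37 and 41.
fourGDD-36 : FourGDD 36
fourGDD-36 = fromGroupedDifferences 36 29 refl (multiples (1 ∷ 16 ∷ 111 ∷ 36 ∷ 141 ∷ 81 ∷ 136 ∷ [])
  ((0 ∷ 1 ∷ 3 ∷ 26 ∷ 85 ∷ []) ∷ [])) refl

fourGDD-40 : FourGDD 40
fourGDD-40 = fromDifferences 40 (multiples (1 ∷ [])
  ((0 ∷ 42 ∷ 56 ∷ 126 ∷ 154 ∷ []) ∷ (0 ∷ 21 ∷ 65 ∷ 88 ∷ 134 ∷ []) ∷ (0 ∷ 3 ∷ 1 ∷ 60 ∷ 100 ∷ []) ∷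
   (0 ∷ 118 ∷ 93 ∷ 106 ∷ 123 ∷ []) ∷ (0 ∷ 26 ∷ 116 ∷ 37 ∷ 8 ∷ []) ∷ (0 ∷ 34 ∷ 10 ∷ 19 ∷ 85 ∷ []) ∷
   (0 ∷ 103 ∷ 125 ∷ 157 ∷ 16 ∷ []) ∷ (0 ∷ 80 ∷ 33 ∷ 111 ∷ 39 ∷ []) ∷ [])) refl

fourGDD-46 : FourGDD 46
fourGDD-46 = fromGroupedDifferences 46 37 refl (multiples (1 ∷ 16 ∷ 71 ∷ 26 ∷ 46 ∷ 181 ∷ 121 ∷ 86 ∷ 81 ∷ [])
  ((0 ∷ 1 ∷ 3 ∷ 20 ∷ 161 ∷ []) ∷ [])) refl

fourGDD-50 : FourGDD 50
fourGDD-50 = fromDifferences 50 (multiples (1 ∷ [])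
  ((0 ∷ 67 ∷ 34 ∷ 52 ∷ 115 ∷ []) ∷ (0 ∷ 19 ∷ 2 ∷ 3 ∷ 12 ∷ []) ∷ (0 ∷ 100 ∷ 74 ∷ 111 ∷ 42 ∷ []) ∷
   (0 ∷ 82 ∷ 125 ∷ 87 ∷ 147 ∷ []) ∷ (0 ∷ 46 ∷ 6 ∷ 102 ∷ 172 ∷ []) ∷
   (0 ∷ 94 ∷ 21 ∷ 156 ∷ 133 ∷ []) ∷ (0 ∷ 61 ∷ 174 ∷ 144 ∷ 97 ∷ []) ∷ (0 ∷ 4 ∷ 24 ∷ 95 ∷ 146 ∷ []) ∷
   (0 ∷ 148 ∷ 84 ∷ 98 ∷ 176 ∷ []) ∷ (0 ∷ 49 ∷ 93 ∷ 8 ∷ 80 ∷ []) ∷ [])) refl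

fourGDD-51 : FourGDD 51
fourGDD-51 = fromGroupedDifferences 51 41 refl (multiples (1 ∷ 16 ∷ 51 ∷ 201 ∷ 141 ∷ [])
  ((0 ∷ 1 ∷ 3 ∷ 10 ∷ 60 ∷ []) ∷ (0 ∷ 18 ∷ 44 ∷ 117 ∷ 138 ∷ []) ∷ [])) refl

fourGDD-70 : FourGDD 70
fourGDD-70 = fromDifferences 70 (multiples (1 ∷ 181 ∷ 165 ∷ 79 ∷ 249 ∷ 109 ∷ 59 ∷ [])
  ((0 ∷ 1 ∷ 3 ∷ 7 ∷ 15 ∷ []) ∷ (0 ∷ 21 ∷ 10 ∷ 58 ∷ 127 ∷ []) ∷ [])) refl

fourGDD-90 : FourGDD 90
fourGDD-90 = fromDifferences 90 (multiples (1 ∷ 28 ∷ 62 ∷ 292 ∷ 234 ∷ 54 ∷ 68 ∷ 99 ∷ 245 ∷ [])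
  ((0 ∷ 1 ∷ 3 ∷ 7 ∷ 15 ∷ []) ∷ (0 ∷ 45 ∷ 21 ∷ 164 ∷ 325 ∷ []) ∷ [])) refl

-- With H = {1, 5, 25, 54, 57}, the fifth roots of unity modulo 71, the base blocks are {0} ∪ H, 2 H
-- and 7 H.
pbd-71 : PairwiseBalanced (Fin 71) (Smaller 71)
pbd-71 = Cyclic.ungrouped 1 71 (multiples (1 ∷ [])
  ((0 ∷ 1 ∷ 5 ∷ 25 ∷ 54 ∷ 57 ∷ []) ∷ (2 ∷ 10 ∷ 50 ∷ 37 ∷ 43 ∷ []) ∷ (7 ∷ 35 ∷ 33 ∷ 23 ∷ 44 ∷ []) ∷
   [])) (smaller? 71) refl (Fin-irrelevant (s≤s z≤n))

pbd-91 : PairwiseBalanced (Fin 91) (Smaller 91)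
pbd-91 = Cyclic.ungrouped 1 91 (multiples (1 ∷ 16 ∷ 74 ∷ [])
  ((0 ∷ 1 ∷ 3 ∷ 7 ∷ 25 ∷ 38 ∷ []) ∷ [])) (smaller? 91) refl (Fin-irrelevant (s≤s z≤n))

-- The cosets of the subgroup of order 5 become blocks of size 5, or of size 6 with a point at
-- infinity; both sizes are admissible, so one family serves orders 75 and 76.
base-75 : List (List (Mod (5 * 15)))
base-75 = multiples (1 ∷ [])
  ((0 ∷ 26 ∷ 1 ∷ 23 ∷ 66 ∷ []) ∷ (0 ∷ 4 ∷ 6 ∷ 11 ∷ 48 ∷ 62 ∷ []) ∷ (0 ∷ 12 ∷ 20 ∷ 41 ∷ 59 ∷ []) ∷ [])

pbd-75 : PairwiseBalanced (Fin 75) (Smaller 75)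
pbd-75 = Cyclic.filled 5 15 base-75 (smaller? 75) refl z≤n (witness (smaller? 75 5) refl)

pbd-76 : PairwiseBalanced (Fin 76) (Smaller 76)
pbd-76 = Cyclic.filled 5 15 base-75 (smaller? 76) refl (s≤s z≤n) (witness (smaller? 76 6) refl)

base-85 : List (List (Mod (5 * 17)))
base-85 = multiples (1 ∷ [])
  ((0 ∷ 26 ∷ 80 ∷ 69 ∷ 14 ∷ []) ∷ (0 ∷ 10 ∷ 4 ∷ 25 ∷ 28 ∷ []) ∷ (0 ∷ 23 ∷ 36 ∷ 56 ∷ 58 ∷ []) ∷
   (0 ∷ 32 ∷ 39 ∷ 76 ∷ 77 ∷ []) ∷ [])

pbd-86 : PairwiseBalanced (Fin 86) (Smaller 86)
pbd-86 = Cyclic.filled 5 17 base-85 (smaller? 86) refl (s≤s z≤n) (witness (smaller? 86 6) refl)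

base-95 : List (List (Mod (5 * 19)))
base-95 = multiples (1 ∷ [])
  ((0 ∷ 9 ∷ 79 ∷ 29 ∷ 30 ∷ []) ∷ (0 ∷ 3 ∷ 5 ∷ 56 ∷ 83 ∷ 87 ∷ []) ∷ (0 ∷ 43 ∷ 7 ∷ 61 ∷ 67 ∷ []) ∷
   (0 ∷ 10 ∷ 32 ∷ 58 ∷ 72 ∷ []) ∷ [])

pbd-95 : PairwiseBalanced (Fin 95) (Smaller 95)
pbd-95 = Cyclic.filled 5 19 base-95 (smaller? 95) refl z≤n (witness (smaller? 95 5) refl)

-- TD(5, 16) as the product of TD(5, 4) with itself.

pbd-80 : PairwiseBalanced (Fin 80) (Smaller 80)
pbd-80 = relabelPoints (≅-trans ((Fin-× ×-≅ ≅-refl) ⊎-≅ ≅-refl) (≅-trans (Fin-× ⊎-≅ ≅-refl) Fin-⊎))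
  (fill Fin._≟_ (weaken (λ { refl → witness (smaller? 80 5) refl })
    (inflate fourGDD-5 λ { refl → fourGDD-5 })) z≤n
    (λ _ → 16) (λ γ i → (γ , proj₁ (from (Fin-× {4} {4}) i)) , proj₂ (from (Fin-× {4} {4}) i))
    (λ γ {i} {j} eq → trans (sym (to-from (Fin-× {4} {4}) i)) (trans (cong (to (Fin-× {4} {4}))
      (cong₂ _,_ (cong (proj₂ ∘ proj₁) eq) (cong proj₂ eq))) (to-from (Fin-× {4} {4}) j)))
    (λ _ _ → refl)
    (λ ((γ , a) , b) → to (Fin-× {4} {4}) (a , b) , cong (λ (a , b) → (γ , a) , b)
      (from-to (Fin-× {4} {4}) (a , b)))
    (λ _ → witness (smaller? 80 16) refl))

-- Orders reached by truncated transversal designs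

Units : ℕ → ℕ → Set
Units k m = ∀ d → 0 < d → d < k → Unit m d

-- A truncated TD(k + 1, m) with w points at infinity has order r.

Fits : ℕ → ℕ × ℕ × ℕ → Set
Fits r (k , m , w) =
  x ≤ m × k * m + x + w ≡ r × Smaller r k × Smaller r (suc k) × Smaller r (m + w) × Smaller r (x + w)
  where x = r ∸ (k * m + w)

fits? : ∀ r f → Dec (Fits r f)
fits? r (k , m , w) =
  x ℕ.≤? m ×-dec k * m + x + w ℕ.≟ r ×-dec
  smaller? r k ×-dec smaller? r (suc k) ×-dec smaller? r (m + w) ×-dec smaller? r (x + w)
  where x = r ∸ (k * m + w)

truncatedOrder : ∀ {r k m x w} → 0 < m → w ≤ 1 → Units k m → x ≤ m → k * m + x + w ≡ r →
                 Smaller r k → Smaller r (suc k) → Smaller r (m + w) → Smaller r (x + w) →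
                 PairwiseBalanced (Fin r) (Smaller r)
truncatedOrder {r} {x = x} {w} 0<m w≤1 units x≤m r≡ Kk Ksk Kmw Kxw
  with z , refl ← ℕ.m≤n⇒∃[o]m+o≡n x≤m =
  subst (λ r′ → PairwiseBalanced (Fin r′) (Smaller r)) r≡
    (fillTruncated {Smaller r} {x = x} {z} {w} {{ℕ.>-nonZero 0<m}} units w≤1 Kk Ksk Kmw Kxw)

-- A modulus prime to 6 makes 2 and 3 invertible, with inverses linear in j; the inverse of 4 is the
-- square of that of 2.
units-1 : ∀ j → Units 5 (1 + 6 * j)
units-1 j 1 _ _ = 1 , 0 , refl
units-1 j 2 _ _ = 3 * j + 1 , 1 , lemma j
  where lemma : ∀ j → (3 * j + 1) * 2 ≡ 1 + 1 * (1 + 6 * j)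
        lemma = solve-∀
units-1 j 3 _ _ = 4 * j + 1 , 2 , lemma j
  where lemma : ∀ j → (4 * j + 1) * 3 ≡ 1 + 2 * (1 + 6 * j)
        lemma = solve-∀
units-1 j 4 _ _ = (3 * j + 1) * (3 * j + 1) , 3 + 6 * j , lemma j
  where lemma : ∀ j → (3 * j + 1) * (3 * j + 1) * 4 ≡ 1 + (3 + 6 * j) * (1 + 6 * j)
        lemma = solve-∀
units-1 j (suc (suc (suc (suc (suc _))))) _ (s≤s (s≤s (s≤s (s≤s (s≤s ())))))

units-5 : ∀ j → Units 5 (5 + 6 * j)
units-5 j 1 _ _ = 1 , 0 , refl
units-5 j 2 _ _ = 3 * j + 3 , 1 , lemma j
  where lemma : ∀ j → (3 * j + 3) * 2 ≡ 1 + 1 * (5 + 6 * j)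
        lemma = solve-∀
units-5 j 3 _ _ = 2 * j + 2 , 1 , lemma j
  where lemma : ∀ j → (2 * j + 2) * 3 ≡ 1 + 1 * (5 + 6 * j)
        lemma = solve-∀
units-5 j 4 _ _ = (3 * j + 3) * (3 * j + 3) , 7 + 6 * j , lemma j
  where lemma : ∀ j → (3 * j + 3) * (3 * j + 3) * 4 ≡ 1 + (7 + 6 * j) * (5 + 6 * j)
        lemma = solve-∀
units-5 j (suc (suc (suc (suc (suc _))))) _ (s≤s (s≤s (s≤s (s≤s (s≤s ())))))

%5-+ : ∀ a b c → a ≡ b + c * 5 → a % 5 ≡ b % 5
%5-+ a b c refl = [m+kn]%n≡m%n b c 5

-- With r = 5 + s + 150 q the column sizes m = 30 q + 1, 5, 11, 25, all prime to 6
-- and 0 or 1 modulo 5, serve for s < 20, 50, 120, 150; then x = r − 5 m ≤ m.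

module LargeOrder {r q s} (305≤r : 305 ≤ r) (2≤q : 2 ≤ q) (s<150 : s < 150)
                  (r≡ : r ≡ 5 + s + q * 150) (r%5≤1 : r % 5 ≤ 1) where

  -- Since r = 5 m + x, the residue of x modulo 5 is that of r, so only the residue of m is asked
  -- for. The bound 70 serves to put x below r.
  use : ∀ m x c t → 0 < m → Units 5 m → x ≤ m → x ≤ 70 → 5 * m + x + 0 ≡ r → m ≡ t + c * 5 → t % 5 ≤ 1 →
        PairwiseBalanced (Fin r) (Smaller r)
  use m x c t 0<m units x≤m x≤70 5m+x≡r m≡ t%5≤1 =
    truncatedOrder 0<m z≤n units x≤m 5m+x≡r
      (ℕ.≤-trans (ℕ.m≤n+m 6 299) 305≤r , z≤n) (ℕ.≤-trans (ℕ.m≤n+m 7 298) 305≤r , s≤s z≤n)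
      (subst (_< r) (sym (ℕ.+-identityʳ m)) m<r ,
       subst (_≤ 1) (sym (trans (cong (_% 5) (ℕ.+-identityʳ m)) (%5-+ m t c m≡))) t%5≤1)
      (subst (_< r) (sym (ℕ.+-identityʳ x)) (ℕ.≤-trans (s≤s x≤70) (ℕ.≤-trans (ℕ.m≤n+m 71 234) 305≤r)) ,
       subst (_≤ 1) (trans (%5-+ r (x + 0) m (trans (sym 5m+x≡r) (lemma m x))) refl) r%5≤1)
    where
    lemma : ∀ m x → 5 * m + x + 0 ≡ (x + 0) + m * 5
    lemma = solve-∀
    lemma′ : ∀ m x → 5 * m + x + 0 ≡ m + (m + (3 * m + x))
    lemma′ = solve-∀
    m<r : m < r
    m<r = subst (m <_) (trans (sym (lemma′ m x)) 5m+x≡r) (ℕ.m<m+n m (ℕ.≤-trans 0<m (ℕ.m≤m+n m (3 * m + x))))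

  offset : ∀ {l e} → l + e ≡ s → ∀ {u} → s < l + u → e < u
  offset {l} {e} l+e≡s s<l+u = ℕ.+-cancelˡ-< l e _ (subst (_< _) (sym l+e≡s) s<l+u)

  order : ∀ {l e} → l + e ≡ s → ∀ {n} → n ≡ 5 + (l + e) + q * 150 → n ≡ r
  order l+e≡s n≡ = trans n≡ (trans (cong (λ s → 5 + s + q * 150) l+e≡s) (sym r≡))

  -- The columns grow with q while the bounds on x do not, so q = 2 is the worst case. There
  -- `design₃` is tight, with m = 71 and x < 70; for q = 1 it would have m = 41. This is the origin
  -- of the threshold 305 = 5 + 2 · 150.
  column-size : ∀ a b → a + 6 * (5 * 2 + b) ≤ a + 6 * (5 * q + b)
  column-size a b = ℕ.+-monoʳ-≤ a (ℕ.*-monoʳ-≤ 6 (ℕ.+-monoˡ-≤ b (ℕ.*-monoʳ-≤ 5 2≤q)))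

  design₁ : s < 20 → PairwiseBalanced (Fin r) (Smaller r)
  design₁ s<20 =
    use (1 + 6 * (5 * q + 0)) s (6 * q) 1 (s≤s z≤n) (units-1 (5 * q + 0))
      (ℕ.≤-trans (ℕ.<⇒≤ s<20) (ℕ.≤-trans (ℕ.m≤n+m 20 41) (column-size 1 0)))
      (ℕ.≤-trans (ℕ.<⇒≤ s<20) (ℕ.m≤n+m 20 50)) (order {0} refl (lemma s q)) (lemma′ q) (s≤s z≤n)
    where
    lemma : ∀ s q → 5 * (1 + 6 * (5 * q + 0)) + s + 0 ≡ 5 + (0 + s) + q * 150
    lemma = solve-∀
    lemma′ : ∀ q → 1 + 6 * (5 * q + 0) ≡ 1 + 6 * q * 5
    lemma′ = solve-∀
  design₂ : ∀ e → 20 + e ≡ s → s < 50 → PairwiseBalanced (Fin r) (Smaller r)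
  design₂ e 20+e≡s s<50 =
    let e<30 = offset {20} 20+e≡s s<50 in
    use (5 + 6 * (5 * q + 0)) e (1 + 6 * q) 0 (s≤s z≤n) (units-5 (5 * q + 0))
      (ℕ.≤-trans (ℕ.<⇒≤ e<30) (ℕ.≤-trans (ℕ.m≤n+m 30 35) (column-size 5 0)))
      (ℕ.≤-trans (ℕ.<⇒≤ e<30) (ℕ.m≤n+m 30 40)) (order {20} 20+e≡s (lemma e q)) (lemma′ q) z≤n
    where
    lemma : ∀ e q → 5 * (5 + 6 * (5 * q + 0)) + e + 0 ≡ 5 + (20 + e) + q * 150
    lemma = solve-∀
    lemma′ : ∀ q → 5 + 6 * (5 * q + 0) ≡ 0 + (1 + 6 * q) * 5
    lemma′ = solve-∀
  design₃ : ∀ e → 50 + e ≡ s → s < 120 → PairwiseBalanced (Fin r) (Smaller r)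
  design₃ e 50+e≡s s<120 =
    let e<70 = offset {50} 50+e≡s s<120 in
    use (5 + 6 * (5 * q + 1)) e (2 + 6 * q) 1 (s≤s z≤n) (units-5 (5 * q + 1))
      (ℕ.≤-trans (ℕ.<⇒≤ e<70) (ℕ.≤-trans (ℕ.m≤n+m 70 1) (column-size 5 1)))
      (ℕ.<⇒≤ e<70) (order {50} 50+e≡s (lemma e q)) (lemma′ q) (s≤s z≤n)
    where
    lemma : ∀ e q → 5 * (5 + 6 * (5 * q + 1)) + e + 0 ≡ 5 + (50 + e) + q * 150
    lemma = solve-∀
    lemma′ : ∀ q → 5 + 6 * (5 * q + 1) ≡ 1 + (2 + 6 * q) * 5
    lemma′ = solve-∀
  design₄ : ∀ e → 120 + e ≡ s → PairwiseBalanced (Fin r) (Smaller r)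
  design₄ e 120+e≡s =
    let e<30 = offset {120} 120+e≡s s<150 in
    use (1 + 6 * (5 * q + 4)) e (5 + 6 * q) 0 (s≤s z≤n) (units-1 (5 * q + 4))
      (ℕ.≤-trans (ℕ.<⇒≤ e<30) (ℕ.≤-trans (ℕ.m≤n+m 30 55) (column-size 1 4)))
      (ℕ.≤-trans (ℕ.<⇒≤ e<30) (ℕ.m≤n+m 30 40)) (order {120} 120+e≡s (lemma e q)) (lemma′ q) z≤n
    where
    lemma : ∀ e q → 5 * (1 + 6 * (5 * q + 4)) + e + 0 ≡ 5 + (120 + e) + q * 150
    lemma = solve-∀
    lemma′ : ∀ q → 1 + 6 * (5 * q + 4) ≡ 0 + (5 + 6 * q) * 5
    lemma′ = solve-∀

  above : ∀ {l} → l ≤ s → (∀ e → l + e ≡ s → PairwiseBalanced (Fin r) (Smaller r)) →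
          PairwiseBalanced (Fin r) (Smaller r)
  above l≤s D = let e , l+e≡s = ℕ.m≤n⇒∃[o]m+o≡n l≤s in D e l+e≡s

  byOffset : PairwiseBalanced (Fin r) (Smaller r)
  byOffset = split 20 design₁ λ 20≤s → split 50 (λ s<50 → above 20≤s λ e eq → design₂ e eq s<50)
    λ 50≤s → split 120 (λ s<120 → above 50≤s λ e eq → design₃ e eq s<120) λ 120≤s → above 120≤s design₄
    where
    split : ∀ l → (s < l → PairwiseBalanced (Fin r) (Smaller r)) →
            (l ≤ s → PairwiseBalanced (Fin r) (Smaller r)) →
            PairwiseBalanced (Fin r) (Smaller r)
    split l f g = [ f , g ]′ (ℕ.<-≤-connex s l)

largeOrder : ∀ r → 305 ≤ r → r % 5 ≤ 1 → PairwiseBalanced (Fin r) (Smaller r)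
largeOrder r 305≤r = LargeOrder.byOffset {r} {(r ∸ 5) / 150} {(r ∸ 5) % 150} 305≤r
  (/-monoˡ-≤ 150 (ℕ.∸-monoˡ-≤ 5 305≤r)) (m%n<n (r ∸ 5) 150)
  (trans (sym (ℕ.m+[n∸m]≡n {5} (ℕ.≤-trans (ℕ.m≤n+m 5 300) 305≤r)))
    (trans (cong (5 +_) (m≡m%n+[m/n]*n (r ∸ 5) 150))
      (sym (ℕ.+-assoc 5 ((r ∸ 5) % 150) ((r ∸ 5) / 150 * 150)))))

-- The point at infinity makes 19, 29 and 49 usable, whose successors are divisible by 5. Ten
-- columns are possible for m = 11 because 11 is prime, and the block sizes 10 and 11 are
-- admissible.
frames : List (ℕ × ℕ × ℕ)
frames = (5 , 5 , 1) ∷ (5 , 11 , 0) ∷ (5 , 19 , 1) ∷ (5 , 25 , 0) ∷ (5 , 29 , 1) ∷ (5 , 35 , 0) ∷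
         (5 , 41 , 0) ∷ (5 , 49 , 1) ∷ (5 , 55 , 0) ∷ (10 , 11 , 0) ∷ []

ValidFrame : ℕ × ℕ × ℕ → Set
ValidFrame (k , m , w) = 0 < m × w ≤ 1 ×
  -- For positive m the divisor `suc (m ∸ 1)` is m, in a form that is visibly nonzero. Computing the
  -- quotient leaves only u to search for.
  All (λ d → 0 < d → Any (λ u → u * d ≡ 1 + (u * d / suc (m ∸ 1)) * m) (upTo m))
  (upTo k)

validFrame? : ∀ f → Dec (ValidFrame f)
validFrame? (k , m , w) = 0 ℕ.<? m ×-dec w ℕ.≤? 1 ×-dec
  all? (λ d → 0 ℕ.<? d →-dec any? (λ u → u * d ℕ.≟ 1 + (u * d / suc (m ∸ 1)) * m) (upTo m)) (upTo k)

frames-valid : All ValidFrame frames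
frames-valid = witness (all? validFrame? frames) refl

fromFrame : ∀ {r} f → ValidFrame f → Fits r f → PairwiseBalanced (Fin r) (Smaller r)
fromFrame (k , m , w) (0<m , w≤1 , units) (x≤m , r≡ , Kk , Ksk , Kmw , Kxw) =
  truncatedOrder 0<m w≤1
    (λ d 0<d d<k → let u , _ , eq = find (All.lookup units (∈-upTo⁺ d<k) 0<d) in
      u , u * d / suc (m ∸ 1) , eq)
    x≤m r≡ Kk Ksk Kmw Kxw

-- Orders below 305 and the induction

Design : ℕ → Set₁
Design r = FourGDD r ⊎ PairwiseBalanced (Fin r) (Smaller r)

seeds : List ℕ
seeds = 0 ∷ 1 ∷ 5 ∷ 6 ∷ 10 ∷ 11 ∷ 15 ∷ 16 ∷ 20 ∷ 35 ∷ 36 ∷ 40 ∷ 46 ∷ 50 ∷ 51 ∷ 70 ∷ 90 ∷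
        71 ∷ 75 ∷ 76 ∷ 80 ∷ 86 ∷ 91 ∷ 95 ∷ []

seed-designs : All Design seeds
seed-designs =
  inj₁ fourGDD-0 ∷ inj₁ fourGDD-1 ∷ inj₁ fourGDD-5 ∷ inj₁ fourGDD-6 ∷ inj₁ fourGDD-10 ∷
  inj₁ fourGDD-11 ∷ inj₁ fourGDD-15 ∷ inj₁ fourGDD-16 ∷
  inj₁ fourGDD-20 ∷ inj₁ fourGDD-35 ∷ inj₁ fourGDD-36 ∷ inj₁ fourGDD-40 ∷ inj₁ fourGDD-46 ∷
  inj₁ fourGDD-50 ∷ inj₁ fourGDD-51 ∷ inj₁ fourGDD-70 ∷ inj₁ fourGDD-90 ∷
  inj₂ pbd-71 ∷ inj₂ pbd-75 ∷ inj₂ pbd-76 ∷ inj₂ pbd-80 ∷ inj₂ pbd-86 ∷ inj₂ pbd-91 ∷ inj₂ pbd-95 ∷ []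

-- In the middle case r = 4 s + 1 with s admissible, so the BIBD obtained from s is a pairwise
-- balanced design on r points. The condition 5 < r keeps its blocks smaller than the design.
SmallOrder : ℕ → Set
SmallOrder r = r ∈ˡ seeds ⊎ (r / 4 * 4 + 1 ≡ r × Smaller r (r / 4) × Smaller r 5) ⊎ Any (Fits r) frames

smallOrders : All (λ r → r % 5 ≤ 1 → SmallOrder r) (upTo 305)
smallOrders = witness (all? (λ r → r % 5 ℕ.≤? 1 →-dec
  (r ∈ˡ? seeds ⊎-dec (r / 4 * 4 + 1 ℕ.≟ r ×-dec smaller? r (r / 4) ×-dec smaller? r 5)
    ⊎-dec any? (fits? r) frames))
  (upTo 305)) refl

smallDesign : ∀ {r} → (∀ {s} → Smaller r s → FourGDD s) → SmallOrder r → Design r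
smallDesign ih (inj₁ r∈seeds) = All.lookup seed-designs r∈seeds
smallDesign {r} ih (inj₂ (inj₁ (r≡ , s<r , 5<r))) = inj₂ (weaken (λ { refl → 5<r })
  (subst (λ v → PairwiseBalanced (Fin v) (_≡ 5)) r≡ (toSteiner (ih s<r))))
smallDesign ih (inj₂ (inj₂ fits)) = let f , f∈ , fit = find fits in
  inj₂ (fromFrame f (All.lookup frames-valid f∈) fit)

fourGDD : ∀ r → r % 5 ≤ 1 → FourGDD r
fourGDD = <-rec _ λ r ih r%5≤1 →
  [ id , (λ D → inflate D λ (k<r , k%5≤1) → ih k<r k%5≤1) ]′
    ([ (λ r<305 → smallDesign (λ (s<r , s%5≤1) → ih s<r s%5≤1)
      (All.lookup smallOrders (∈-upTo⁺ {305} {r} r<305) r%5≤1))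
     , (λ 305≤r → inj₂ (largeOrder r 305≤r r%5≤1)) ]′ (ℕ.<-≤-connex r 305))

-- Counting in lists and subsets

module _ {A : Set} {P Q : A → Set} (P? : Decidable P) (Q? : Decidable Q) where

  count-cong : P ≐ Q → ∀ xs → length (filter P? xs) ≡ length (filter Q? xs)
  count-cong P≐Q xs = cong length (filter-≐ P? Q? P≐Q xs)

module _ {A : Set} {P : A → Set} (P? : Decidable P) where

  count-++ : ∀ xs ys → length (filter P? (xs ++ ys)) ≡ length (filter P? xs) + length (filter P? ys)
  count-++ xs ys = trans (cong length (filter-++ P? xs ys)) (length-++ (filter P? xs))

  count-none : (∀ x → P x → Empty.⊥) → ∀ xs → length (filter P? xs) ≡ 0
  count-none none [] = refl
  count-none none (x ∷ xs) with P? x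
  ... | yes p = contradiction p (none x)
  ... | no _  = count-none none xs

  count-every : (∀ x → P x) → ∀ xs → length (filter P? xs) ≡ length xs
  count-every every [] = refl
  count-every every (x ∷ xs) with P? x
  ... | yes _ = cong suc (count-every every xs)
  ... | no ¬p = contradiction (every x) ¬p

  count-once : ∀ {xs a} → Unique xs → a ∈ˡ xs → P a → (∀ {x} → x ∈ˡ xs → P x → x ≡ a) →
               length (filter P? xs) ≡ 1
  count-once {x ∷ xs} (x∉xs ∷ xs!) (here refl) Pa only with P? x
  ... | no ¬p = contradiction Pa ¬p
  ... | yes _ = cong suc (none xs λ y∈ Py → All.lookup x∉xs y∈ (sym (only (there y∈) Py)))
    where
    none : ∀ ys → (∀ {y} → y ∈ˡ ys → P y → Empty.⊥) → length (filter P? ys) ≡ 0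
    none [] _ = refl
    none (y ∷ ys) ¬P with P? y
    ... | yes p = contradiction p (¬P (here refl))
    ... | no _  = none ys (¬P ∘ there)
  count-once {x ∷ xs} (x∉xs ∷ xs!) (there a∈) Pa only with P? x
  ... | yes p = contradiction (only (here refl) p) (All.lookup x∉xs a∈)
  ... | no _  = count-once xs! a∈ Pa (only ∘ there)

count-map : ∀ {A B : Set} {P : B → Set} (P? : Decidable P) (f : A → B) xs →
            length (filter P? (map f xs)) ≡ length (filter (P? ∘ f) xs)
count-map P? f [] = refl
count-map P? f (x ∷ xs) with does (P? (f x))
... | true  = cong suc (count-map P? f xs)
... | false = count-map P? f xs

-- The final blocks pair a line of one group with a point of the other, and membership splits
-- accordingly; every count in the final design is a sum of two such products.
count-product : ∀ {A B C : Set} {P : A → Set} {Q : B → Set} {R : C → Set}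
                (P? : Decidable P) (Q? : Decidable Q) (R? : Decidable R) (f : A → B → C) →
                (∀ {x y} → R (f x y) → P x × Q y) → (∀ {x y} → P x → Q y → R (f x y)) → ∀ xs ys →
                length (filter R? (cartesianProductWith f xs ys)) ≡
                length (filter P? xs) * length (filter Q? ys)
count-product P? Q? R? f ⇒ ⇐ [] ys = refl
count-product P? Q? R? f ⇒ ⇐ (x ∷ xs) ys = trans (count-++ R? (map (f x) ys) (cartesianProductWith f xs ys))
  (trans (cong₂ _+_ (count-map R? (f x) ys) (count-product P? Q? R? f ⇒ ⇐ xs ys)) row)
  where
  row : length (filter (R? ∘ f x) ys) + length (filter P? xs) * length (filter Q? ys) ≡
        length (filter P? (x ∷ xs)) * length (filter Q? ys)
  row with P? x
  ... | yes p = cong (_+ length (filter P? xs) * length (filter Q? ys))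
                     (count-cong (R? ∘ f x) Q? ((proj₂ ∘ ⇒) , ⇐ p) ys)
  ... | no ¬p = cong (_+ length (filter P? xs) * length (filter Q? ys))
                     (count-none (R? ∘ f x) (λ _ → ¬p ∘ proj₁ ∘ ⇒) ys)

∣⁅x⁆∪p∣ : ∀ {n} (x : Fin n) {p} → x ∉ p → ∣ ⁅ x ⁆ ∪ p ∣ ≡ suc ∣ p ∣
∣⁅x⁆∪p∣ zero    {inside  ∷ p} x∉p = contradiction here x∉p
∣⁅x⁆∪p∣ zero    {outside ∷ p} x∉p = cong (suc ∘ ∣_∣) (∪-identityˡ p)
∣⁅x⁆∪p∣ (suc x) {inside  ∷ p} x∉p = cong suc (∣⁅x⁆∪p∣ x (x∉p ∘ there))
∣⁅x⁆∪p∣ (suc x) {outside ∷ p} x∉p = ∣⁅x⁆∪p∣ x (x∉p ∘ there)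

image : ∀ {k n} → (Fin k → Fin n) → Subset n
image {zero}  f = ⊥
image {suc k} f = ⁅ f zero ⁆ ∪ image (f ∘ suc)

∈-image⁺ : ∀ {k n} (f : Fin k → Fin n) i → f i ∈ image f
∈-image⁺ f zero    = x∈p∪q⁺ (inj₁ (x∈⁅x⁆ (f zero)))
∈-image⁺ f (suc i) = x∈p∪q⁺ (inj₂ (∈-image⁺ (f ∘ suc) i))

∈-image⁻ : ∀ {k n} (f : Fin k → Fin n) {x} → x ∈ image f → ∃ λ i → f i ≡ x
∈-image⁻ {zero}  f x∈ = contradiction x∈ ∉⊥
∈-image⁻ {suc k} f x∈ with x∈p∪q⁻ ⁅ f zero ⁆ (image (f ∘ suc)) x∈
... | inj₁ x∈⁅⁆ = zero , sym (x∈⁅y⁆⇒x≡y _ x∈⁅⁆)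
... | inj₂ x∈im with i , eq ← ∈-image⁻ (f ∘ suc) x∈im = suc i , eq

∣image∣ : ∀ {k n} (f : Fin k → Fin n) → (∀ {i j} → f i ≡ f j → i ≡ j) → ∣ image f ∣ ≡ k
∣image∣ {zero}  {n} f f-inj = ∣⊥∣≡0 n
∣image∣ {suc k} f f-inj = trans
  (∣⁅x⁆∪p∣ (f zero) (λ f0∈ → case ∈-image⁻ (f ∘ suc) f0∈ of λ (i , eq) → Fin.0≢1+n (sym (f-inj eq))))
  (cong suc (∣image∣ (f ∘ suc) (Fin.suc-injective ∘ f-inj)))

indicator : Bool → ℕ
indicator b = if b then 1 else 0

sum-∈ : ∀ {n} (p : Subset n) → sum (λ x → indicator (does (x ∈? p))) ≡ ∣ p ∣
sum-∈ []            = refl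
sum-∈ (inside  ∷ p) = cong suc (sum-∈ p)
sum-∈ (outside ∷ p) = sum-∈ p

sum-replicate : ∀ n c → sum {n} (λ _ → c) ≡ n * c
sum-replicate zero    c = refl
sum-replicate (suc n) c = cong (c +_) (sum-replicate n c)

concurrence-∷ : ∀ {n} {B : Subset n} {bs x} y → x ∈ B →
                concurrence (B ∷ bs) x y ≡ indicator (does (y ∈? B)) + concurrence bs x y
concurrence-∷ {B = B} {x = x} y x∈B with x ∈? B | does (y ∈? B)
... | no x∉B | _     = contradiction x∈B x∉B
... | yes _  | true  = refl
... | yes _  | false = refl

-- Counting the flags (y , B) with x, y ∈ B in two ways.

sum-concurrence : ∀ {n k} {bs : List (Subset n)} → All (λ B → ∣ B ∣ ≡ k) bs → ∀ x →
                  sum (concurrence bs x) ≡ replication bs x * k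
sum-concurrence {n} [] x = trans (sum-replicate n 0) (ℕ.*-zeroʳ n)
sum-concurrence {n} {k} {B ∷ bs} (∣B∣≡k ∷ sizes) x = byCases (x ∈? B)
  where
  open ≡-Reasoning
  byCases : Dec (x ∈ B) → sum (concurrence (B ∷ bs) x) ≡ replication (B ∷ bs) x * k
  byCases (yes x∈B) = begin
    sum (concurrence (B ∷ bs) x)
      ≡⟨ sum-cong-≗ (λ y → concurrence-∷ {bs = bs} y x∈B) ⟩
    sum (λ y → indicator (does (y ∈? B)) + concurrence bs x y)
      ≡⟨ ∑-distrib-+ (λ y → indicator (does (y ∈? B))) (concurrence bs x) ⟩
    sum (λ y → indicator (does (y ∈? B))) + sum (concurrence bs x)
      ≡⟨ cong₂ _+_ (trans (sum-∈ B) ∣B∣≡k) (sum-concurrence sizes x) ⟩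
    k + replication bs x * k
      ≡⟨ cong (λ bs → length bs * k) (filter-accept (x ∈?_) x∈B) ⟨
    replication (B ∷ bs) x * k ∎
  byCases (no x∉B) = begin
    sum (concurrence (B ∷ bs) x)
      ≡⟨ sum-cong-≗ (λ y → cong length (filter-reject (λ B → (x ∈? B) ×-dec (y ∈? B))
        {xs = bs} (x∉B ∘ proj₁))) ⟩
    sum (concurrence bs x)     ≡⟨ sum-concurrence sizes x ⟩
    replication bs x * k       ≡⟨ cong (λ bs → length bs * k) (filter-reject (x ∈?_) x∉B) ⟨
    replication (B ∷ bs) x * k ∎

-- Steiner systems as lists of lines

record Steiner (k n : ℕ) : Set where
  field
    lines       : List (Subset n)
    line-size   : All (λ B → ∣ B ∣ ≡ suc k) lines
    line-joins  : ∀ {x y} → x ≢ y → concurrence lines x y ≡ 1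

-- The flags at x number ρ (k + 1); the point x itself accounts for ρ of them and each of the other
-- n - 1 points for one.
replication-number : ∀ {k n} (S : Steiner k n) x → replication (Steiner.lines S) x * k + 1 ≡ n
replication-number {k} {suc n} S x = ℕ.+-cancelˡ-≡ ρ _ _ (begin
  ρ + (ρ * k + 1)                                               ≡⟨ ℕ.+-assoc ρ (ρ * k) 1 ⟨
  ρ + ρ * k + 1                                                 ≡⟨ cong (_+ 1) (ℕ.*-suc ρ k) ⟨
  ρ * suc k + 1                                                 ≡⟨ cong (_+ 1)
    (sum-concurrence line-size x) ⟨
  sum (concurrence lines x) + 1                                 ≡⟨ cong (_+ 1)
    (sum-remove {i = x} (concurrence lines x)) ⟩
  concurrence lines x x + sum (removeAt (concurrence lines x) x) + 1
    ≡⟨ cong (_+ 1) (cong₂ _+_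
         (count-cong (λ B → (x ∈? B) ×-dec (x ∈? B)) (x ∈?_) (proj₁ , (λ x∈B → x∈B , x∈B)) lines)
         (trans (sum-cong-≗ (λ i → line-joins (punchInᵢ≢i x i ∘ sym)))
           (trans (sum-replicate n 1) (ℕ.*-identityʳ n)))) ⟩
  ρ + n + 1                                                     ≡⟨ ℕ.+-assoc ρ n 1 ⟩
  ρ + (n + 1)                                                   ≡⟨ cong (ρ +_) (ℕ.+-comm n 1) ⟩
  ρ + suc n                                                     ∎)
  where
  open ≡-Reasoning
  open Steiner S
  ρ : ℕ
  ρ = replication lines x

module FromPairwiseBalanced {n k} (D : PairwiseBalanced (Fin n) (_≡ suc (suc k))) where
  open Lines D

  -- The type of blocks comes without an enumeration. A block is determined by its first two points
  -- in order, so listing the pairs that arise this way lists each block once.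
  Leading : Fin n × Fin n → Set
  Leading (x , y) = ∃ λ b → line b zero ≡ x × line b (suc zero) ≡ y

  -- No search over blocks is needed: the only candidate is the block joining x and y, and the
  -- positions of x and y on it decide.
  leading? : Decidable Leading
  leading? (x , y) with x Fin.≟ y
  ... | yes refl = no λ (b , p , q) → Fin.0≢1+n (line-transversal b (trans p (sym q)))
  ... | no x≢y with line-common x≢y
  ...   | b , i , j , p , q = map′
    (λ { (refl , refl) → b , p , q })
    (λ (b′ , p′ , q′) → same (line-unique {b′} {b} Fin.0≢1+n (trans p′ (sym p)) (trans q′ (sym q))) p′ q′)
    (i Fin.≟ zero ×-dec j Fin.≟ suc zero)
    where
    same : ∀ {b′} → b′ ≡ b → line b′ zero ≡ x → line b′ (suc zero) ≡ y → i ≡ zero × j ≡ suc zero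
    same refl p′ q′ = line-transversal b (trans p (sym p′)) , line-transversal b (trans q (sym q′))

  lineThrough : ∀ {p} → Dec (Leading p) → Subset n
  lineThrough (yes (b , _)) = image (line b)
  -- A default that never enters the list, because `pairs` keeps only leading pairs.
  lineThrough (no _)        = ⊥

  lineThrough-leading : ∀ {p} (c? : Dec (Leading p)) ((b , _) : Leading p) → lineThrough c? ≡ image (line b)
  lineThrough-leading (no ¬c) c = contradiction c ¬c
  lineThrough-leading (yes (b′ , p′ , q′)) (b , p , q) =
    cong (image ∘ line) (line-unique {b′} {b} Fin.0≢1+n (trans p′ (sym p)) (trans q′ (sym q)))

  pairs : List (Fin n × Fin n)
  pairs = filter leading? (cartesianProduct (allFin n) (allFin n))

  leading : ∀ {p} → p ∈ˡ pairs → Leading p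
  leading = proj₂ ∘ ∈-filter⁻ leading? {xs = cartesianProduct (allFin n) (allFin n)}

  ∈-pairs : ∀ b → (line b zero , line b (suc zero)) ∈ˡ pairs
  ∈-pairs b = ∈-filter⁺ leading? (∈-cartesianProduct⁺ (∈-allFin _) (∈-allFin _)) (b , refl , refl)

  steiner : Steiner (suc k) n
  steiner = record
    { lines      = map (λ p → lineThrough (leading? p)) pairs
    ; line-size  = All.map⁺ (All.tabulate λ {p} p∈ → trans
        (cong ∣_∣ (lineThrough-leading (leading? p) (leading p∈))) (∣image∣ (line (proj₁ (leading p∈)))
          (line-transversal _)))
    ; line-joins = joins
    }
    where
    joins : ∀ {x y} → x ≢ y → concurrence (map (λ p → lineThrough (leading? p)) pairs) x y ≡ 1
    joins {x} {y} x≢y =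
      let b , i , j , p , q = line-common x≢y
          eq = lineThrough-leading (leading? (line b zero , line b (suc zero))) (b , refl , refl)
      in trans (count-map (λ B → (x ∈? B) ×-dec (y ∈? B)) (λ p → lineThrough (leading? p)) pairs)
        (count-once (λ r → (x ∈? lineThrough (leading? r)) ×-dec (y ∈? lineThrough (leading? r)))
          (Unique.filter⁺ leading? (Unique.cartesianProduct⁺ (Unique.allFin⁺ n) (Unique.allFin⁺ n)))
          (∈-pairs b)
          (subst (x ∈_) (sym eq) (subst (_∈ image (line b)) p (∈-image⁺ (line b) i)) ,
           subst (y ∈_) (sym eq) (subst (_∈ image (line b)) q (∈-image⁺ (line b) j)))
          (λ {r} r∈ (x∈ , y∈) → only p q (leading r∈)
            (subst (x ∈_) (lineThrough-leading (leading? r) (leading r∈)) x∈)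
            (subst (y ∈_) (lineThrough-leading (leading? r) (leading r∈)) y∈)))
      where
      only : ∀ {b i j r} → line b i ≡ x → line b j ≡ y → ((b′ , _) : Leading r) →
             x ∈ image (line b′) → y ∈ image (line b′) → r ≡ (line b zero , line b (suc zero))
      only {b} {i} {j} p q (b′ , s , t) x∈ y∈ =
        let i′ , p′ = ∈-image⁻ (line b′) x∈
            j′ , q′ = ∈-image⁻ (line b′) y∈
            b≡ = line-unique {b} {b′} (λ { refl → x≢y (trans (sym p) q) }) (trans p (sym p′))
                 (trans q (sym q′))
        in cong₂ _,_ (trans (sym s) (cong (λ b → line b zero) (sym b≡)))
                     (trans (sym t) (cong (λ b → line b (suc zero)) (sym b≡)))

-- Assembling the design on two groups

∣⧺∣ : ∀ {a b} (p : Subset a) (q : Subset b) → ∣ p ⧺ q ∣ ≡ ∣ p ∣ + ∣ q ∣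
∣⧺∣ []            q = refl
∣⧺∣ (inside  ∷ p) q = cong suc (∣⧺∣ p q)
∣⧺∣ (outside ∷ p) q = ∣⧺∣ p q

module _ {a b} (p : Subset a) (q : Subset b) where

  ∈-⧺ˡ⁺ : ∀ {i} → i ∈ p → i ↑ˡ b ∈ p ⧺ q
  ∈-⧺ˡ⁺ {i} i∈p = lookup⇒[]= (i ↑ˡ b) (p ⧺ q) (trans (lookup-++ˡ p q i) ([]=⇒lookup i∈p))

  ∈-⧺ˡ⁻ : ∀ {i} → i ↑ˡ b ∈ p ⧺ q → i ∈ p
  ∈-⧺ˡ⁻ {i} i∈ = lookup⇒[]= i p (trans (sym (lookup-++ˡ p q i)) ([]=⇒lookup i∈))

  ∈-⧺ʳ⁺ : ∀ {j} → j ∈ q → a ↑ʳ j ∈ p ⧺ q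
  ∈-⧺ʳ⁺ {j} j∈q = lookup⇒[]= (a ↑ʳ j) (p ⧺ q) (trans (lookup-++ʳ p q j) ([]=⇒lookup j∈q))

  ∈-⧺ʳ⁻ : ∀ {j} → a ↑ʳ j ∈ p ⧺ q → j ∈ q
  ∈-⧺ʳ⁻ {j} j∈ = lookup⇒[]= j q (trans (sym (lookup-++ʳ p q j)) ([]=⇒lookup j∈))

data Side {a b} : Fin (a + b) → Set where
  left  : ∀ i → Side (i ↑ˡ b)
  right : ∀ j → Side (a ↑ʳ j)

side : ∀ {a b} (x : Fin (a + b)) → Side {a} {b} x
side {a} {b} x = subst Side (join-splitAt a b x) (from-split (splitAt a x))
  where
  from-split : ∀ u → Side (join a b u)
  from-split (inj₁ i) = left i
  from-split (inj₂ j) = right j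

count-singleton : ∀ {n} (x : Fin n) → length (filter (λ y → x ∈? ⁅ y ⁆) (allFin n)) ≡ 1
count-singleton {n} x = count-once (λ y → x ∈? ⁅ y ⁆) (Unique.allFin⁺ n) (∈-allFin x) (x∈⁅x⁆ x)
  (λ {y} _ x∈ → sym (x∈⁅y⁆⇒x≡y y x∈))

count-pair : ∀ {n} {x x′ : Fin n} → x ≢ x′ →
             length (filter (λ y → (x ∈? ⁅ y ⁆) ×-dec (x′ ∈? ⁅ y ⁆)) (allFin n)) ≡ 0
count-pair {n} {x} {x′} x≢x′ = count-none (λ y → (x ∈? ⁅ y ⁆) ×-dec (x′ ∈? ⁅ y ⁆))
  (λ y (x∈ , x′∈) → x≢x′ (trans (x∈⁅y⁆⇒x≡y y x∈) (sym (x∈⁅y⁆⇒x≡y y x′∈)))) (allFin n)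

-- Stands for a factor of `count-product` on which membership puts no condition.
always? : ∀ {A : Set} (x : A) → Dec Unit.⊤
always? _ = yes Unit.tt

-- The orders a and b are kept apart because `2 * n` computes to `n + (n + 0)`, so the second group
-- lives on `Fin (n + 0)`.
module Assemble {k a b} (S : Steiner k a) (T : Steiner k b) (b≡a : b ≡ a)
                (∣S∣≡∣T∣ : length (Steiner.lines S) ≡ length (Steiner.lines T)) where

  module S = Steiner S
  module T = Steiner T

  extendˡ : Subset a → Fin b → Subset (a + b)
  extendˡ B y = B ⧺ ⁅ y ⁆

  extendʳ : Subset b → Fin a → Subset (a + b)
  extendʳ B x = ⁅ x ⁆ ⧺ B

  blocksˡ blocksʳ blocks : List (Subset (a + b))
  blocksˡ = cartesianProductWith extendˡ S.lines (allFin b)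
  blocksʳ = cartesianProductWith extendʳ T.lines (allFin a)
  blocks  = blocksˡ ++ blocksʳ

  length-allFin : ∀ n → length (allFin n) ≡ n
  length-allFin n = length-tabulate id

  all-blocks : ∀ {P : Subset (a + b) → Set} →
               (∀ {B} → ∣ B ∣ ≡ suc k → ∀ y → P (extendˡ B y)) →
               (∀ {B} → ∣ B ∣ ≡ suc k → ∀ x → P (extendʳ B x)) → All P blocks
  all-blocks Pˡ Pʳ = All.++⁺
    (All.cartesianProductWith⁺ (setoid _) (setoid _) extendˡ S.lines (allFin b)
      (λ {B} {y} B∈ _ → Pˡ {B} (All.lookup S.line-size B∈) y))
    (All.cartesianProductWith⁺ (setoid _) (setoid _) extendʳ T.lines (allFin a)
      (λ {B} {x} B∈ _ → Pʳ {B} (All.lookup T.line-size B∈) x))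

  concurrence-left : ∀ {i i′} → i ≢ i′ → concurrence blocks (i ↑ˡ b) (i′ ↑ˡ b) ≡ a
  concurrence-left {i} {i′} i≢i′ = begin
    concurrence blocks (i ↑ˡ b) (i′ ↑ˡ b)
      ≡⟨ count-++ R? blocksˡ blocksʳ ⟩
    length (filter R? blocksˡ) + length (filter R? blocksʳ)
      ≡⟨ cong₂ _+_
        (count-product (λ B → (i ∈? B) ×-dec (i′ ∈? B)) always? R? extendˡ
          (λ {B} {y} (i∈ , i′∈) → (∈-⧺ˡ⁻ B ⁅ y ⁆ i∈ , ∈-⧺ˡ⁻ B ⁅ y ⁆ i′∈) , Unit.tt)
            (λ {B} {y} (i∈ , i′∈) _ → ∈-⧺ˡ⁺ B ⁅ y ⁆ i∈ , ∈-⧺ˡ⁺ B ⁅ y ⁆ i′∈) S.lines (allFin b))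
        (count-product always? (λ x → (i ∈? ⁅ x ⁆) ×-dec (i′ ∈? ⁅ x ⁆)) R? extendʳ
          (λ {B} {x} (i∈ , i′∈) → Unit.tt , (∈-⧺ˡ⁻ ⁅ x ⁆ B i∈ , ∈-⧺ˡ⁻ ⁅ x ⁆ B i′∈))
            (λ {B} {x} _ (i∈ , i′∈) → ∈-⧺ˡ⁺ ⁅ x ⁆ B i∈ , ∈-⧺ˡ⁺ ⁅ x ⁆ B i′∈) T.lines (allFin a)) ⟩
    _ ≡⟨ cong₂ _+_ (cong₂ _*_ (S.line-joins i≢i′)
      (trans (count-every always? (λ _ → Unit.tt) (allFin b)) (length-allFin b)))
                   (cong (length (filter always? T.lines) *_) (count-pair i≢i′)) ⟩
    1 * b + length (filter always? T.lines) * 0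
      ≡⟨ cong₂ _+_ (ℕ.*-identityˡ b) (ℕ.*-zeroʳ (length (filter always? T.lines))) ⟩
    b + 0 ≡⟨ ℕ.+-identityʳ b ⟩
    b     ≡⟨ b≡a ⟩
    a     ∎
    where
    open ≡-Reasoning
    R? = λ C → (i ↑ˡ b ∈? C) ×-dec (i′ ↑ˡ b ∈? C)

  concurrence-right : ∀ {j j′} → j ≢ j′ → concurrence blocks (a ↑ʳ j) (a ↑ʳ j′) ≡ a
  concurrence-right {j} {j′} j≢j′ = begin
    concurrence blocks (a ↑ʳ j) (a ↑ʳ j′)
      ≡⟨ count-++ R? blocksˡ blocksʳ ⟩
    length (filter R? blocksˡ) + length (filter R? blocksʳ)
      ≡⟨ cong₂ _+_
        (count-product always? (λ y → (j ∈? ⁅ y ⁆) ×-dec (j′ ∈? ⁅ y ⁆)) R? extendˡ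
          (λ {B} {y} (j∈ , j′∈) → Unit.tt , (∈-⧺ʳ⁻ B ⁅ y ⁆ j∈ , ∈-⧺ʳ⁻ B ⁅ y ⁆ j′∈))
            (λ {B} {y} _ (j∈ , j′∈) → ∈-⧺ʳ⁺ B ⁅ y ⁆ j∈ , ∈-⧺ʳ⁺ B ⁅ y ⁆ j′∈) S.lines (allFin b))
        (count-product (λ B → (j ∈? B) ×-dec (j′ ∈? B)) always? R? extendʳ
          (λ {B} {x} (j∈ , j′∈) → (∈-⧺ʳ⁻ ⁅ x ⁆ B j∈ , ∈-⧺ʳ⁻ ⁅ x ⁆ B j′∈) , Unit.tt)
            (λ {B} {x} (j∈ , j′∈) _ → ∈-⧺ʳ⁺ ⁅ x ⁆ B j∈ , ∈-⧺ʳ⁺ ⁅ x ⁆ B j′∈) T.lines (allFin a)) ⟩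
    _ ≡⟨ cong₂ _+_ (cong (length (filter always? S.lines) *_) (count-pair j≢j′))
                   (cong₂ _*_ (T.line-joins j≢j′) (trans (count-every always? (λ _ → Unit.tt)
                     (allFin a)) (length-allFin a))) ⟩
    length (filter always? S.lines) * 0 + 1 * a
      ≡⟨ cong₂ _+_ (ℕ.*-zeroʳ (length (filter always? S.lines))) (ℕ.*-identityˡ a) ⟩
    a     ∎
    where
    open ≡-Reasoning
    R? = λ C → (a ↑ʳ j ∈? C) ×-dec (a ↑ʳ j′ ∈? C)

  concurrence-across : ∀ i j → concurrence blocks (i ↑ˡ b) (a ↑ʳ j) ≡
                       replication S.lines i + replication T.lines j
  concurrence-across i j = begin
    concurrence blocks (i ↑ˡ b) (a ↑ʳ j)
      ≡⟨ count-++ R? blocksˡ blocksʳ ⟩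
    length (filter R? blocksˡ) + length (filter R? blocksʳ)
      ≡⟨ cong₂ _+_
        (count-product (i ∈?_) (λ y → j ∈? ⁅ y ⁆) R? extendˡ
          (λ {B} {y} (i∈ , j∈) → ∈-⧺ˡ⁻ B ⁅ y ⁆ i∈ , ∈-⧺ʳ⁻ B ⁅ y ⁆ j∈)
            (λ {B} {y} i∈ j∈ → ∈-⧺ˡ⁺ B ⁅ y ⁆ i∈ , ∈-⧺ʳ⁺ B ⁅ y ⁆ j∈) S.lines (allFin b))
        (count-product (j ∈?_) (λ x → i ∈? ⁅ x ⁆) R? extendʳ
          (λ {B} {x} (i∈ , j∈) → ∈-⧺ʳ⁻ ⁅ x ⁆ B j∈ , ∈-⧺ˡ⁻ ⁅ x ⁆ B i∈)
            (λ {B} {x} j∈ i∈ → ∈-⧺ˡ⁺ ⁅ x ⁆ B i∈ , ∈-⧺ʳ⁺ ⁅ x ⁆ B j∈) T.lines (allFin a)) ⟩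
    _ ≡⟨ cong₂ _+_ (trans (cong (replication S.lines i *_) (count-singleton j))
      (ℕ.*-identityʳ (replication S.lines i)))
                   (trans (cong (replication T.lines j *_) (count-singleton i))
                     (ℕ.*-identityʳ (replication T.lines j))) ⟩
    replication S.lines i + replication T.lines j ∎
    where
    open ≡-Reasoning
    R? = λ C → (i ↑ˡ b ∈? C) ×-dec (a ↑ʳ j ∈? C)

  -- Each line through i has b extensions, and each line of the other group is extended by i exactly
  -- once.
  replication-left : ∀ i → replication blocks (i ↑ˡ b) ≡ replication S.lines i * b + length T.lines
  replication-left i = begin
    replication blocks (i ↑ˡ b)
      ≡⟨ count-++ (i ↑ˡ b ∈?_) blocksˡ blocksʳ ⟩
    length (filter (i ↑ˡ b ∈?_) blocksˡ) + length (filter (i ↑ˡ b ∈?_) blocksʳ)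
      ≡⟨ cong₂ _+_
        (count-product (i ∈?_) always? (i ↑ˡ b ∈?_) extendˡ (λ {B} {y} i∈ → ∈-⧺ˡ⁻ B ⁅ y ⁆ i∈ , Unit.tt)
          (λ {B} {y} i∈ _ → ∈-⧺ˡ⁺ B ⁅ y ⁆ i∈) S.lines (allFin b))
        (count-product always? (λ x → i ∈? ⁅ x ⁆) (i ↑ˡ b ∈?_) extendʳ (λ {B} {x} i∈ → Unit.tt ,
          ∈-⧺ˡ⁻ ⁅ x ⁆ B i∈) (λ {B} {x} _ i∈ → ∈-⧺ˡ⁺ ⁅ x ⁆ B i∈) T.lines (allFin a)) ⟩
    _ ≡⟨ cong₂ _+_ (cong (replication S.lines i *_)
      (trans (count-every always? (λ _ → Unit.tt) (allFin b)) (length-allFin b)))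
                   (trans (cong₂ _*_ (count-every always? (λ _ → Unit.tt) T.lines) (count-singleton i))
                     (ℕ.*-identityʳ (length T.lines))) ⟩
    replication S.lines i * b + length T.lines ∎
    where open ≡-Reasoning

  replication-right : ∀ j → replication blocks (a ↑ʳ j) ≡ replication T.lines j * a + length S.lines
  replication-right j = begin
    replication blocks (a ↑ʳ j)
      ≡⟨ count-++ (a ↑ʳ j ∈?_) blocksˡ blocksʳ ⟩
    length (filter (a ↑ʳ j ∈?_) blocksˡ) + length (filter (a ↑ʳ j ∈?_) blocksʳ)
      ≡⟨ cong₂ _+_
        (count-product always? (λ y → j ∈? ⁅ y ⁆) (a ↑ʳ j ∈?_) extendˡ (λ {B} {y} j∈ → Unit.tt ,
          ∈-⧺ʳ⁻ B ⁅ y ⁆ j∈) (λ {B} {y} _ j∈ → ∈-⧺ʳ⁺ B ⁅ y ⁆ j∈) S.lines (allFin b))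
        (count-product (j ∈?_) always? (a ↑ʳ j ∈?_) extendʳ (λ {B} {x} j∈ → ∈-⧺ʳ⁻ ⁅ x ⁆ B j∈ , Unit.tt)
          (λ {B} {x} j∈ _ → ∈-⧺ʳ⁺ ⁅ x ⁆ B j∈) T.lines (allFin a)) ⟩
    _ ≡⟨ cong₂ _+_ (trans (cong₂ _*_ (count-every always? (λ _ → Unit.tt) S.lines) (count-singleton j))
      (ℕ.*-identityʳ (length S.lines)))
                   (cong (replication T.lines j *_)
                     (trans (count-every always? (λ _ → Unit.tt) (allFin a)) (length-allFin a))) ⟩
    length S.lines + replication T.lines j * a ≡⟨ ℕ.+-comm (length S.lines) (replication T.lines j * a) ⟩
    replication T.lines j * a + length S.lines ∎
    where open ≡-Reasoning

  block-size : All (λ B → ∣ B ∣ ≡ suc k + 1) blocks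
  block-size = all-blocks
    (λ {B} ∣B∣ y → trans (∣⧺∣ B ⁅ y ⁆) (cong₂ _+_ ∣B∣ (∣⁅x⁆∣≡1 y)))
    (λ {B} ∣B∣ x → trans (∣⧺∣ ⁅ x ⁆ B) (trans (cong₂ _+_ (∣⁅x⁆∣≡1 x) ∣B∣) (ℕ.+-comm 1 (suc k))))

  group : Fin 2 → Subset (a + b)
  group zero       = ⊤ {a} ⧺ ⊥ {b}
  group (suc zero) = ⊥ {a} ⧺ ⊤ {b}

  group-size : ∀ g → ∣ group g ∣ ≡ a
  group-size zero       = trans (∣⧺∣ (⊤ {a}) (⊥ {b})) (trans (cong₂ _+_ (∣⊤∣≡n a) (∣⊥∣≡0 b))
    (ℕ.+-identityʳ a))
  group-size (suc zero) = trans (∣⧺∣ (⊥ {a}) (⊤ {b})) (trans (cong₂ _+_ (∣⊥∣≡0 a) (∣⊤∣≡n b)) b≡a)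

  left-group : ∀ {g} i → i ↑ˡ b ∈ group g → zero ≡ g
  left-group {zero}     _ _  = refl
  left-group {suc zero} _ i∈ = contradiction (∈-⧺ˡ⁻ (⊥ {a}) (⊤ {b}) i∈) ∉⊥

  right-group : ∀ {g} j → a ↑ʳ j ∈ group g → suc zero ≡ g
  right-group {zero}     _ j∈ = contradiction (∈-⧺ʳ⁻ (⊤ {a}) (⊥ {b}) j∈) ∉⊥
  right-group {suc zero} _ _  = refl

  group-partition : ∀ x → ∃! _≡_ (λ g → x ∈ group g)
  group-partition x with side {a} {b} x
  ... | left i  = zero , ∈-⧺ˡ⁺ (⊤ {a}) (⊥ {b}) ∈⊤ , λ {g} → left-group {g} i
  ... | right j = suc zero , ∈-⧺ʳ⁺ (⊥ {a}) (⊤ {b}) ∈⊤ , λ {g} → right-group {g} j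

  same-group : ∀ {g x y} → x ∈ group g → y ∈ group g → x ≢ y → concurrence blocks x y ≡ a
  same-group {g} {x} {y} x∈ y∈ x≢y with side {a} {b} x | side {a} {b} y
  ... | left i  | left i′  = concurrence-left (x≢y ∘ cong (_↑ˡ b))
  ... | right j | right j′ = concurrence-right (x≢y ∘ cong (a ↑ʳ_))
  ... | left i  | right j  = contradiction (trans (left-group {g} i x∈) (sym (right-group {g} j y∈)))
    Fin.0≢1+n
  ... | right j | left i   = contradiction (trans (left-group {g} i y∈) (sym (right-group {g} j x∈)))
    Fin.0≢1+n

  concurrence-comm : ∀ x y → concurrence blocks x y ≡ concurrence blocks y x
  concurrence-comm x y = count-cong (λ B → (x ∈? B) ×-dec (y ∈? B)) (λ B → (y ∈? B) ×-dec (x ∈? B))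
    ((λ (x∈ , y∈) → y∈ , x∈) , (λ (y∈ , x∈) → x∈ , y∈)) blocks

  different-group : ∀ {ρ} → (∀ i → replication S.lines i ≡ ρ) → (∀ j → replication T.lines j ≡ ρ) →
                    ∀ {g h x y} → g ≢ h → x ∈ group g → y ∈ group h → concurrence blocks x y ≡ ρ + ρ
  different-group ρS ρT {g} {h} {x} {y} g≢h x∈ y∈ with side {a} {b} x | side {a} {b} y
  ... | left i  | left i′  = contradiction (trans (sym (left-group {g} i x∈)) (left-group {h} i′ y∈)) g≢h
  ... | right j | right j′ = contradiction (trans (sym (right-group {g} j x∈)) (right-group {h} j′ y∈)) g≢h
  ... | left i  | right j  = trans (concurrence-across i j) (cong₂ _+_ (ρS i) (ρT j))
  ... | right j | left i   = trans (concurrence-comm (a ↑ʳ j) (i ↑ˡ b))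
                                   (trans (concurrence-across i j) (cong₂ _+_ (ρS i) (ρT j)))

  regular : ∀ {ρ} → (∀ i → replication S.lines i ≡ ρ) → (∀ j → replication T.lines j ≡ ρ) →
            ∀ x → replication blocks x ≡ ρ * a + length S.lines
  regular {ρ} ρS ρT x with side {a} {b} x
  ... | left i  = trans (replication-left i) (cong₂ _+_ (cong₂ _*_ (ρS i) b≡a) (sym ∣S∣≡∣T∣))
  ... | right j = trans (replication-right j) (cong (λ ρ → ρ * a + length S.lines) (ρT j))

  configuration : All (λ B → ∃₂ λ g h → g ≢ h × ∣ B ∩ group g ∣ ≡ 1 × ∣ B ∩ group h ∣ ≡ suc k) blocks
  configuration = all-blocks
    (λ {B} ∣B∣ y → suc zero , zero , (λ ()) ,
      trans (∣∩∣ B ⁅ y ⁆ ⊥ ⊤) (trans (cong₂ (λ p q → ∣ p ∣ + ∣ q ∣) (∩-zeroʳ B) (∩-identityʳ ⁅ y ⁆))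
        (cong₂ _+_ (∣⊥∣≡0 a) (∣⁅x⁆∣≡1 y))) ,
      trans (∣∩∣ B ⁅ y ⁆ ⊤ ⊥) (trans (cong₂ (λ p q → ∣ p ∣ + ∣ q ∣) (∩-identityʳ B) (∩-zeroʳ ⁅ y ⁆))
        (trans (cong₂ _+_ ∣B∣ (∣⊥∣≡0 b)) (ℕ.+-identityʳ (suc k)))))
    (λ {B} ∣B∣ x → zero , suc zero , (λ ()) ,
      trans (∣∩∣ ⁅ x ⁆ B ⊤ ⊥) (trans (cong₂ (λ p q → ∣ p ∣ + ∣ q ∣) (∩-identityʳ ⁅ x ⁆) (∩-zeroʳ B))
        (cong₂ _+_ (∣⁅x⁆∣≡1 x) (∣⊥∣≡0 b))) ,
      trans (∣∩∣ ⁅ x ⁆ B ⊥ ⊤) (trans (cong₂ (λ p q → ∣ p ∣ + ∣ q ∣) (∩-zeroʳ ⁅ x ⁆) (∩-identityʳ B))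
        (cong₂ _+_ (∣⊥∣≡0 a) ∣B∣)))
    where
    ∣∩∣ : ∀ (p : Subset a) (q : Subset b) p′ q′ → ∣ (p ⧺ q) ∩ (p′ ⧺ q′) ∣ ≡ ∣ p ∩ p′ ∣ + ∣ q ∩ q′ ∣
    ∣∩∣ p q p′ q′ = trans (cong ∣_∣ (zipWith-++ _ p q p′ q′)) (∣⧺∣ (p ∩ p′) (q ∩ q′))

-- Lines of odd size 2 k + 1 give ρ = (n - 1) / (2 k), so that the index ρ + ρ across the groups
-- becomes (n - 1) / k.
steiner⇒GDD : ∀ {k n} → .{{_ : ℕ.NonZero k}} → Steiner (k * 2) n →
  Σ (GDD n 2 (suc (k * 2) + 1) n ((n ∸ 1) / k)) (HasConfiguration 1 (suc (k * 2)))
steiner⇒GDD {k} {n} S = record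
  { group           = group
  ; group-size      = group-size
  ; group-partition = group-partition
  ; blocks          = blocks
  ; block-size      = block-size
  ; r               = ρ * n + length (Steiner.lines S)
  ; regular         = regular ρS ρT
  ; same-group      = λ {g} → same-group {g}
  ; different-group = λ {g} {h} {x} g≢h x∈ y∈ → trans (different-group ρS ρT {g} {h} g≢h x∈ y∈)
                                                (ρ+ρ (someone x))
  } , configuration
  where
  n+0≡n : n + 0 ≡ n
  n+0≡n = ℕ.+-identityʳ n

  copy : Steiner (k * 2) (n + 0)
  copy = subst (Steiner (k * 2)) (sym n+0≡n) S

  length-copy : ∀ {m} (eq : n ≡ m) → length (Steiner.lines S) ≡
                length (Steiner.lines (subst (Steiner (k * 2)) eq S))
  length-copy refl = refl

  open Assemble S copy n+0≡n (length-copy (sym n+0≡n))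

  ρ : ℕ
  -- Defined by division because the field `r` must be given before any point is available.
  ρ = (n ∸ 1) / k / 2

  n∸1 : ∀ {ρ′ m} → ρ′ * (k * 2) + 1 ≡ m → m ∸ 1 ≡ ρ′ * 2 * k
  n∸1 {ρ′} refl = trans (ℕ.m+n∸n≡m (ρ′ * (k * 2)) 1) (lemma ρ′ k)
    where lemma : ∀ ρ k → ρ * (k * 2) ≡ ρ * 2 * k
          lemma = solve-∀

  quotient : ∀ ρ′ → ρ′ * (k * 2) + 1 ≡ n → (n ∸ 1) / k ≡ ρ′ * 2
  quotient ρ′ eq = trans (cong (_/ k) (n∸1 {ρ′} eq)) (m*n/n≡m (ρ′ * 2) k)

  ρ-unique : ∀ ρ′ → ρ′ * (k * 2) + 1 ≡ n → ρ′ ≡ ρ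
  ρ-unique ρ′ eq = sym (trans (cong (_/ 2) (quotient ρ′ eq)) (m*n/n≡m ρ′ 2))

  ρS : ∀ i → replication (Steiner.lines S) i ≡ ρ
  ρS i = ρ-unique (replication (Steiner.lines S) i) (replication-number S i)

  ρT : ∀ j → replication (Steiner.lines copy) j ≡ ρ
  ρT j = ρ-unique (replication (Steiner.lines copy) j) (trans (replication-number copy j) n+0≡n)

  -- That the division is exact is read off from the replication number of some point, which is
  -- extracted here from x.
  someone : Fin (n + (n + 0)) → Fin n
  someone x with side {n} {n + 0} x
  ... | left i  = i
  ... | right j = subst Fin n+0≡n j

  ρ+ρ : Fin n → ρ + ρ ≡ (n ∸ 1) / k
  ρ+ρ i = trans (trans (lemma ρ) (cong (_* 2) (sym (ρS i))))
    (sym (quotient (replication (Steiner.lines S) i) (replication-number S i)))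
    where lemma : ∀ ρ → ρ + ρ ≡ ρ * 2
          lemma = solve-∀

corollary7p1 : (n : ℕ) → 5 ≤ n → (n % 20 ≡ 1 ⊎ n % 20 ≡ 5) →
    Σ (GDD n 2 6 n ((n ∸ 1) / 2)) (HasConfiguration 1 5)
corollary7p1 n _ n%20 = steiner⇒GDD {2} (FromPairwiseBalanced.steiner (design n%20))
  where
  ofOrder : ∀ r → r % 5 ≤ 1 → n ≡ r * 4 + 1 → PairwiseBalanced (Fin n) (_≡ 5)
  ofOrder r r%5≤1 n≡ = subst (λ v → PairwiseBalanced (Fin v) (_≡ 5)) (sym n≡) (toSteiner (fourGDD r r%5≤1))

  n≡ : ∀ {c} → n % 20 ≡ c → n ≡ c + n / 20 * 20
  n≡ n%20≡c = trans (m≡m%n+[m/n]*n n 20) (cong (_+ n / 20 * 20) n%20≡c)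

  design : n % 20 ≡ 1 ⊎ n % 20 ≡ 5 → PairwiseBalanced (Fin n) (_≡ 5)
  design (inj₁ n%20≡1) = ofOrder (0 + n / 20 * 5) (subst (_≤ 1) (sym ([m+kn]%n≡m%n 0 (n / 20) 5)) z≤n)
    (trans (n≡ n%20≡1) (lemma (n / 20)))
    where lemma : ∀ q → 1 + q * 20 ≡ (0 + q * 5) * 4 + 1
          lemma = solve-∀
  design (inj₂ n%20≡5) = ofOrder (1 + n / 20 * 5) (subst (_≤ 1) (sym ([m+kn]%n≡m%n 1 (n / 20) 5)) (s≤s z≤n))
    (trans (n≡ n%20≡5) (lemma (n / 20)))
    where lemma : ∀ q → 5 + q * 20 ≡ (1 + q * 5) * 4 + 1
          lemma = solve-∀
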